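{- Suppose that $p\in \mathbb{Z}[z]$ is a polynomial of degree at least 2 with a positive leading coefficient, and let $a$ and $b$ be positive integers with $\gcd(a,b)=1$. Suppose that there exist positive integers $d$ and $u$, and integers $t$ and $v$, such that the following six conditions hold: (1) $(a+b)t\equiv p(t) \pmod{d}$; (2) for every integer $k\equiv t\pmod{d}$, $a\mid p(k+d)-p(k)$; (3) for every integer $k\equiv t\pmod{d}$, letting $m=\frac{p(k+d)-p(k)}{a}$, we have $u\mid m$, and $m'=\frac{m}{u}$ satisfies $2\nmid m'$ and $\gcd(a,m')=\gcd(b,m')=\gcd(u,m')=1$; (4) $p(v)\equiv (a+b)v \pmod{u}$; (5) for every integer $k\equiv t\pmod{d}$, $p(k)\equiv (a+b)v\pmod{u}$; (6) for all integers $j\equiv v\pmod{u}$ and $k\equiv t\pmod{d}$, $b\mid p(k)-aj$. Then the equation $ax+by=p(z)$ is 2-Ramsey.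
   Context: For $k\in\mathbb{Z}^+$, an equation in the variables $x,y,z$ is called $k$-Ramsey if every colouring of the positive integers $\mathbb{Z}^+$ with $k$ colours admits infinitely many monochromatic solutions $(x,y,z)\in(\mathbb{Z}^+)^3$, i.e. solutions with $x,y,z$ all receiving the same colour. -}

module Defs where

open import Data.Nat using (ℕ; _<_; _≤_; _+_)
open import Data.Integer as ℤ using (ℤ; +_; 0ℤ)
open import Data.Integer.Divisibility using (_∣_)
open import Data.Fin using (Fin)
open import Data.List using (List; []; _∷_; _++_; length)
open import Data.Product using (Σ; ∃; _×_)
open import Relation.Binary.PropositionalEquality using (_≡_)

-- Integer polynomials as coefficient lists, constant term first:
-- c₀ ∷ c₁ ∷ … ∷ cₙ represents c₀ + c₁ z + … + cₙ zⁿ.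
eval : List ℤ → ℤ → ℤ
eval []       z = 0ℤ
eval (c ∷ cs) z = c ℤ.+ z ℤ.* eval cs z

Deg≥2PosLead : List ℤ → Set
Deg≥2PosLead p = Σ (List ℤ) λ cs → Σ ℤ λ c →
  (p ≡ cs ++ (c ∷ [])) × (2 ≤ length cs) × (0ℤ ℤ.< c)

infix 4 _≡_[mod_]
_≡_[mod_] : ℤ → ℤ → ℤ → Set
x ≡ y [mod m ] = m ∣ (x ℤ.- y)

-- A k-colouring of the positive integers (the value at 0 is irrelevant).
Colouring : ℕ → Set
Colouring k = ℕ → Fin k

-- An equation in x y z, given as the predicate of its solutions.
-- E is k-Ramsey iff every k-colouring admits infinitely many monochromatic
-- solutions in positive integers; "infinitely many" is rendered as
-- "unboundedly many": for every N there is one with x + y + z > N.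
Ramsey : ℕ → (ℕ → ℕ → ℕ → Set) → Set
Ramsey k E = (c : Colouring k) → (N : ℕ) →
  Σ ℕ λ x → Σ ℕ λ y → Σ ℕ λ z →
    (0 < x) × (0 < y) × (0 < z) × E x y z ×
    (c x ≡ c y) × (c y ≡ c z) × (N < x + y + z)

LinPolyEq : ℕ → ℕ → List ℤ → ℕ → ℕ → ℕ → Set
LinPolyEq a b p x y z = (+ a) ℤ.* (+ x) ℤ.+ (+ b) ℤ.* (+ y) ≡ eval p (+ z)

{-# OPTIONS --safe #-}
-- Write γ κ = c (t₀ + dκ) for the class t mod d and χ X = c (v₀ + uX) for the class v mod u.
-- By (1), (4) and (5) the equation restricts to aX + bY = Q(κ) on the first class, and to
-- aX + bY = P(z) on the second for every z in either class.  Call κ a switch if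
-- k = t₀ + dκ and k + d have different colours, say α and β.
--
-- Near a switch: (6) lets x of colour α pass through y = (p(k) − ax)/b, so without solutions
-- colour α propagates from X to X + m′ on the second class.  If some z of that class, much smaller
-- than k, has colour β, test every residue mod m′ at height about P(z).  The map
-- X ↦ (P(z) − aX)/b sends β-residues to α-residues and X ↦ (P(k) − bX)/a sends α-residues to
-- β-residues; both are injective, so the two sets have equal size although m′ is odd.
--
-- Hence z has colour α, and switches of opposite directions within a bounded ratio would force
-- contradictory colours on a common z.  So the colour of the first class is constant for a long
-- way on both sides of a switch κ.  Solving aX + bY = Q(κ) with X ≈ κ and aX + bY = Q(κ+1) with
-- X ≈ κ + 1 then produces a switch from β to α near Q(κ)/b, so colour β extends well below it
-- and contains X, Y ≈ Q(κ+1)/(a+b); together with κ + 1 this is a solution.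
--
-- Constructively, the set of solutions plays the role of ⊥ throughout.
module Submission where

open import Defs
open import Data.Nat using (ℕ; _<_)
open import Data.Integer as ℤ using (ℤ; +_; 1ℤ)
open import Data.Integer.Divisibility using (_∣_)
open import Data.Integer.GCD using (gcd)
open import Data.List using (List)
open import Data.Product using (Σ; _×_)
open import Relation.Nullary using (¬_)
open import Relation.Binary.PropositionalEquality using (_≡_)

open import Data.Fin using (Fin; zero; suc; toℕ; fromℕ<; punchIn; punchOut)
import Data.Fin.Properties as Fin
open import Data.Integer using (-[1+_]; 0ℤ; ∣_∣)
open import Data.Integer.DivMod using (_%ℕ_; _/ℕ_; n%ℕd<d; a≡a%ℕn+[a/ℕn]*n)
open import Data.Integer.Divisibility.Signed as Signed using (∣ᵤ⇒∣; ∣⇒∣ᵤ)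
import Data.Integer.Properties as ℤ
import Data.Integer.Tactic.RingSolver as ℤ
open import Data.List using ([]; _∷_; _++_; length)
open import Data.List.Properties using (length-++)
open import Data.Nat
open import Data.Nat.Coprimality
  using (Coprime; 1-coprimeTo; coprime-Bézout; coprime-divisor; gcd≡1⇒coprime)
  renaming (sym to coprime-sym)
open import Data.Nat.DivMod
  using (m≡m%n+[m/n]*n; m%n<n; m/n*n≤m; /-mono-≤; m*n/n≡m; m≥n⇒m/n>0)
import Data.Nat.Divisibility as ℕ
open import Data.Nat.GCD using (module Bézout)
open import Data.Nat.Properties
open import Data.Nat.Tactic.RingSolver using (solve-∀)
open import Algebra.Properties.CommutativeMonoid.Sum +-0-commutativeMonoid
  using (sum; sum-remove; sum-cong-≗; ∑-distrib-+)
open import Data.Product using (∃; ∃₂; _,_; proj₁; proj₂)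
open import Data.Sum using (_⊎_; inj₁; inj₂)
open import Data.Vec.Functional using (removeAt)
open import Function using (_∘_)
open import Relation.Nullary using (Dec; yes; no; contradiction)
open import Relation.Binary.PropositionalEquality

-- A Farkas certificate: y − x = (q − p) + e.
≤-from : ∀ {p q x y} e → p ≤ q → x + q + e ≡ y + p → x ≤ y
≤-from {p} {q} {x} {y} e p≤q eq = +-cancelʳ-≤ q x y (begin
  x + q      ≤⟨ m≤m+n (x + q) e ⟩
  x + q + e  ≡⟨ eq ⟩
  y + p      ≤⟨ +-monoʳ-≤ y p≤q ⟩
  y + q      ∎)
  where open ≤-Reasoning

-- Counting in two-coloured finite sets

two-colours : ∀ {α β : Fin 2} → α ≢ β → ∀ x → (x ≡ α) ⊎ (x ≡ β)
two-colours {zero}     {zero}     α≢β _          = contradiction refl α≢β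
two-colours {zero}     {suc zero} _   zero       = inj₁ refl
two-colours {zero}     {suc zero} _   (suc zero) = inj₂ refl
two-colours {suc zero} {zero}     _   zero       = inj₂ refl
two-colours {suc zero} {zero}     _   (suc zero) = inj₁ refl
two-colours {suc zero} {suc zero} α≢β _          = contradiction refl α≢β

-- Induction on `m`: the term at `φ zero` is split off both sums, and `punchOut` turns the rest of
-- `φ` into an injection into the remaining indices.
sum-injective-≤ : ∀ {m n} (g : Fin n → ℕ) (φ : Fin m → Fin n) →
  (∀ {i j} → φ i ≡ φ j → i ≡ j) → sum (g ∘ φ) ≤ sum g
sum-injective-≤ {zero}  g φ inj = z≤n
sum-injective-≤ {suc m} {zero} g φ inj with φ zero
... | ()
sum-injective-≤ {suc m} {suc n} g φ inj = begin
  g p + sum (g ∘ φ ∘ suc)          ≡⟨ cong (λ w → g p + w) (sum-cong-≗ λ i → cong g (sym (Fin.punchIn-punchOut (p≢ i)))) ⟩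
  g p + sum (removeAt g p ∘ φ′)    ≤⟨ +-monoʳ-≤ (g p) (sum-injective-≤ (removeAt g p) φ′ inj′) ⟩
  g p + sum (removeAt g p)         ≡⟨ sum-remove {i = p} g ⟨
  sum g                            ∎
  where
  open ≤-Reasoning
  p = φ zero
  p≢ : ∀ i → p ≢ φ (suc i)
  p≢ i eq with inj eq
  ... | ()
  φ′ : Fin m → Fin n
  φ′ i = punchOut (p≢ i)
  inj′ : ∀ {i j} → φ′ i ≡ φ′ j → i ≡ j
  inj′ {i} {j} eq = Fin.suc-injective (inj (Fin.punchOut-injective (p≢ i) (p≢ j) eq))

sum-mono-≤ : ∀ {n} (f g : Fin n → ℕ) → (∀ i → f i ≤ g i) → sum f ≤ sum g
sum-mono-≤ {zero}  f g f≤g = z≤n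
sum-mono-≤ {suc n} f g f≤g = +-mono-≤ (f≤g zero) (sum-mono-≤ (f ∘ suc) (g ∘ suc) (f≤g ∘ suc))

sum-1 : ∀ n → sum {n} (λ _ → 1) ≡ n
sum-1 zero    = refl
sum-1 (suc n) = cong suc (sum-1 n)

-- If both alternatives fail, `φ` injects the `α`-class into the `β`-class and `ψ` injects it back,
-- so the classes have equal size and `n` is even. The alternatives are decided by finite search,
-- which keeps the disjunction constructive.
odd-no-swap : ∀ {n} → ¬ (2 ℕ.∣ n) → {α β : Fin 2} → α ≢ β → (χ : Fin n → Fin 2) →
  (φ ψ : Fin n → Fin n) →
  (∀ {i j} → φ i ≡ φ j → i ≡ j) → (∀ {i j} → ψ i ≡ ψ j → i ≡ j) →
  (∃ λ i → χ i ≡ α × χ (φ i) ≡ α) ⊎ (∃ λ i → χ i ≡ β × χ (ψ i) ≡ β)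
odd-no-swap {n} 2∤n {α} {β} α≢β χ φ ψ φ-inj ψ-inj
  with Fin.any? (λ i → both? (χ i) α (χ (φ i))) | Fin.any? (λ i → both? (χ i) β (χ (ψ i)))
  where
  both? : ∀ (x y z : Fin 2) → Dec (x ≡ y × z ≡ y)
  both? x y z with x Fin.≟ y | z Fin.≟ y
  ... | yes p | yes q = yes (p , q)
  ... | no ¬p | _     = no (¬p ∘ proj₁)
  ... | _     | no ¬q = no (¬q ∘ proj₂)
... | yes h | _     = inj₁ h
... | no _  | yes h = inj₂ h
... | no ¬φ | no ¬ψ = contradiction (ℕ.divides (sum [α]) n≡) 2∤n
  where
  ind : Fin 2 → Fin 2 → ℕ
  ind γ x with x Fin.≟ γ
  ... | yes _ = 1
  ... | no  _ = 0

  [α] [β] : Fin n → ℕ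
  [α] = ind α ∘ χ
  [β] = ind β ∘ χ

  ind-self : ∀ {γ x} → x ≡ γ → ind γ x ≡ 1
  ind-self {γ} {x} eq with x Fin.≟ γ
  ... | yes _ = refl
  ... | no ne = contradiction eq ne

  ind-other : ∀ {γ δ x} → γ ≢ δ → x ≡ δ → ind γ x ≡ 0
  ind-other {γ} {δ} {x} γ≢δ eq with x Fin.≟ γ
  ... | yes x≡γ = contradiction (trans (sym x≡γ) eq) γ≢δ
  ... | no _    = refl

  ind-≤ : ∀ {γ δ} → γ ≢ δ → ∀ x y → ¬ (x ≡ γ × y ≡ γ) → ind γ x ≤ ind δ y
  ind-≤ {γ} {δ} γ≢δ x y ¬both with x Fin.≟ γ
  ... | no _ = z≤n
  ... | yes x≡γ with two-colours γ≢δ y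
  ...   | inj₁ y≡γ = contradiction (x≡γ , y≡γ) ¬both
  ...   | inj₂ y≡δ = ≤-reflexive (sym (ind-self y≡δ))

  α≤β : sum [α] ≤ sum [β]
  α≤β = ≤-trans (sum-mono-≤ _ _ λ i → ind-≤ α≢β (χ i) (χ (φ i)) (λ h → ¬φ (i , h)))
                (sum-injective-≤ [β] φ φ-inj)

  β≤α : sum [β] ≤ sum [α]
  β≤α = ≤-trans (sum-mono-≤ _ _ λ i → ind-≤ (α≢β ∘ sym) (χ i) (χ (ψ i)) (λ h → ¬ψ (i , h)))
                (sum-injective-≤ [α] ψ ψ-inj)

  α+β : ∀ i → [α] i + [β] i ≡ 1
  α+β i with two-colours α≢β (χ i)
  ... | inj₁ eq = cong₂ _+_ (ind-self eq) (ind-other (α≢β ∘ sym) eq)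
  ... | inj₂ eq = cong₂ _+_ (ind-other α≢β eq) (ind-self eq)

  n≡ : n ≡ sum [α] * 2
  n≡ = begin
    n                              ≡⟨ sum-1 n ⟨
    sum {n} (λ _ → 1)              ≡⟨ sum-cong-≗ α+β ⟨
    sum (λ i → [α] i + [β] i)      ≡⟨ ∑-distrib-+ [α] [β] ⟩
    sum [α] + sum [β]              ≡⟨ cong (λ w → sum [α] + w) (≤-antisym β≤α α≤β) ⟩
    sum [α] + sum [α]              ≡⟨ double (sum [α]) ⟩
    sum [α] * 2                    ∎
    where
    open ≡-Reasoning
    double : ∀ x → x + x ≡ x * 2
    double = solve-∀

-- Linear equations

-- The hypothesis is the congruence `A * i ≡ Q` modulo `B`, written without subtraction. For
-- positive `B`, the bound `A * i ≤ Q` forces `e₂ ≤ e₁`, so `e₁ ∸ e₂` is a true difference.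
solution-from-congruence : ∀ {A B Q i e₁ e₂} → A * i ≤ Q → A * i + B * e₁ ≡ Q + B * e₂ →
  ∃ λ Y → A * i + B * Y ≡ Q
solution-from-congruence {A} {zero} {Q} {i} {e₁} {e₂} Ai≤Q eq = 0 , +-cancelʳ-≡ 0 _ _ (trans (+-identityʳ _) eq)
solution-from-congruence {A} {B@(suc _)} {Q} {i} {e₁} {e₂} Ai≤Q eq = e₁ ∸ e₂ ,
  +-cancelʳ-≡ (B * e₂) _ _ (begin
    A * i + B * (e₁ ∸ e₂) + B * e₂    ≡⟨ +-assoc (A * i) _ _ ⟩
    A * i + (B * (e₁ ∸ e₂) + B * e₂)  ≡⟨ cong (λ w → A * i + w) (*-distribˡ-+ B (e₁ ∸ e₂) e₂) ⟨
    A * i + B * (e₁ ∸ e₂ + e₂)        ≡⟨ cong (λ e → A * i + B * e) (m∸n+n≡m e₂≤e₁) ⟩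
    A * i + B * e₁                    ≡⟨ eq ⟩
    Q + B * e₂                        ∎)
  where
  open ≡-Reasoning
  rearrange : ∀ x q s t → t + (q + (x + s)) + 0 ≡ s + (x + (q + t))
  rearrange = solve-∀
  e₂≤e₁ : e₂ ≤ e₁
  e₂≤e₁ = *-cancelˡ-≤ B (≤-from 0 (+-mono-≤ Ai≤Q (≤-reflexive (sym eq)))
    (rearrange (A * i) Q (B * e₁) (B * e₂)))

linear-root : ∀ {A B} Q → Coprime A B → 0 < B → ∃ λ x → ∃₂ λ f₁ f₂ → A * x + B * f₁ ≡ Q + B * f₂
linear-root {A} {B@(suc B′)} Q co _ with coprime-Bézout co
... | Bézout.+- x y eq = x * Q , 0 , y * Q , (begin
        A * (x * Q) + B * 0  ≡⟨ lhs A x Q B ⟩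
        x * A * Q            ≡⟨ cong (_* Q) eq ⟨
        (1 + y * B) * Q      ≡⟨ rhs y Q B ⟩
        Q + B * (y * Q)      ∎)
  where
  open ≡-Reasoning
  lhs : ∀ A x Q B → A * (x * Q) + B * 0 ≡ x * A * Q
  lhs = solve-∀
  rhs : ∀ y Q B → (1 + y * B) * Q ≡ Q + B * (y * Q)
  rhs = solve-∀
-- Here `1 + x * A ≡ y * B`, so `- x` inverts `A` modulo `B`; since `B′ = B - 1`, the natural number
-- `B′ * x` represents it.
... | Bézout.-+ x y eq = B′ * x * Q , Q , B′ * y * Q , (begin
        A * (B′ * x * Q) + B * Q      ≡⟨ lhs A x Q B′ ⟩
        B′ * Q * (1 + x * A) + Q      ≡⟨ cong (λ w → B′ * Q * w + Q) eq ⟩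
        B′ * Q * (y * B) + Q          ≡⟨ rhs y Q B B′ ⟩
        Q + B * (B′ * y * Q)          ∎)
  where
  open ≡-Reasoning
  lhs : ∀ A x Q B′ → A * (B′ * x * Q) + suc B′ * Q ≡ B′ * Q * (1 + x * A) + Q
  lhs = solve-∀
  rhs : ∀ y Q B B′ → B′ * Q * (y * B) + Q ≡ Q + B * (B′ * y * Q)
  rhs = solve-∀

-- A root modulo `B` is reduced below `B`; then `A * B ≤ Q` leaves a nonnegative remainder for `Y`.
linear-solution : ∀ {A B Q} → Coprime A B → 0 < B → A * B ≤ Q →
  ∃₂ λ i Y → i < B × A * i + B * Y ≡ Q
linear-solution {A} {B@(suc _)} {Q} co 0<B AB≤Q with linear-root Q co 0<B
... | x , f₁ , f₂ , root with solution-from-congruence {A} {B} {Q} {x % B} {A * (x / B) + f₁} {f₂}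
                                (≤-trans (*-monoʳ-≤ A (<⇒≤ (m%n<n x B))) AB≤Q) reduced
  where
  open ≡-Reasoning
  rearrange : ∀ A i B q f → A * i + B * (A * q + f) ≡ A * (i + q * B) + B * f
  rearrange = solve-∀
  reduced : A * (x % B) + B * (A * (x / B) + f₁) ≡ Q + B * f₂
  reduced = begin
    A * (x % B) + B * (A * (x / B) + f₁)  ≡⟨ rearrange A (x % B) B (x / B) f₁ ⟩
    A * (x % B + x / B * B) + B * f₁      ≡⟨ cong (λ w → A * w + B * f₁) (m≡m%n+[m/n]*n x B) ⟨
    A * x + B * f₁                        ≡⟨ root ⟩
    Q + B * f₂                            ∎
...   | Y , eq = x % B , Y , m%n<n x B , eq

abstract
  -- Prescribes the class modulo `n` of the first unknown. Substituting `s + i * n` leaves an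
  -- equation with the coprime coefficients `A * n` and `B` and right-hand side `Q - A * s`.
  offset-solution : ∀ {A B Q} s n → Coprime A B → Coprime n B → 0 < B → A * (s + B * n) ≤ Q →
    ∃₂ λ i Y → i < B × A * (s + i * n) + B * Y ≡ Q
  offset-solution {A} {B} {Q} s n coAB conB 0<B le with linear-solution coAnB 0<B An≤
    where
    As≤Q : A * s ≤ Q
    As≤Q = ≤-trans (*-monoʳ-≤ A (m≤m+n s (B * n))) le
    coAnB : Coprime (A * n) B
    coAnB (d∣An , d∣B) = conB (coprime-divisor (λ (e∣d , e∣A) → coAB (e∣A , ℕ.∣-trans e∣d d∣B)) d∣An , d∣B)
    rearrange : ∀ A s B n y → A * n * B + (y + A * s) + 0 ≡ y + A * (s + B * n)
    rearrange = solve-∀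
    An≤ : A * n * B ≤ Q ∸ A * s
    An≤ = ≤-from 0 (≤-trans le (≤-reflexive (sym (m∸n+n≡m As≤Q)))) (rearrange A s B n (Q ∸ A * s))
  ... | i , Y , i<B , eq = i , Y , i<B , (begin
      A * (s + i * n) + B * Y         ≡⟨ rearrange A s i n (B * Y) ⟩
      A * n * i + B * Y + A * s       ≡⟨ cong (_+ A * s) eq ⟩
      Q ∸ A * s + A * s               ≡⟨ m∸n+n≡m (≤-trans (*-monoʳ-≤ A (m≤m+n s (B * n))) le) ⟩
      Q                               ∎)
    where
    open ≡-Reasoning
    rearrange : ∀ A s i n t → A * (s + i * n) + t ≡ A * n * i + t + A * s
    rearrange = solve-∀

-- The parity argument

-- `n` divides `A * (r′ - r)`, hence `r′ - r`, which is smaller than `n`.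
residue-unique-≤ : ∀ {A n r r′ e e′} → Coprime n A → r ≤ r′ → r′ < n →
  A * r + n * e ≡ A * r′ + n * e′ → r ≡ r′
residue-unique-≤ {A} {n} {r} {r′} {e} {e′} co r≤r′ r′<n eq with m≤n⇒∃[o]m+o≡n r≤r′
... | zero  , refl = sym (+-identityʳ r)
... | suc δ , refl = contradiction (coprime-divisor co n∣Aδ)
                       (ℕ.>⇒∤ (≤-<-trans (m≤n+m (suc δ) r) r′<n))
  where
  rearrange : ∀ A r δ t → A * r + (t + A * δ) ≡ A * (r + δ) + t
  rearrange = solve-∀
  ne≡ : n * e′ + A * suc δ ≡ n * e
  ne≡ = +-cancelˡ-≡ (A * r) _ _ (trans (rearrange A r (suc δ) (n * e′)) (sym eq))
  n∣Aδ : n ℕ.∣ A * suc δ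
  n∣Aδ = ℕ.∣m+n∣m⇒∣n (ℕ.divides e (trans ne≡ (*-comm n e))) (ℕ.divides e′ (*-comm n e′))

residue-unique : ∀ {A n r r′ e e′} → Coprime n A → r < n → r′ < n →
  A * r + n * e ≡ A * r′ + n * e′ → r ≡ r′
residue-unique {r = r} {r′ = r′} co r<n r′<n eq with ≤-total r r′
... | inj₁ r≤r′ = residue-unique-≤ co r≤r′ r′<n eq
... | inj₂ r′≤r = sym (residue-unique-≤ co r′≤r r<n (sym eq))

-- `n` is the odd number `m′` of a switch `k`. `P` and `W` are the right-hand sides of the equation
-- restricted to the class of `v`, at `k` and at the smaller `z`. `step` says that `α` can fail to
-- propagate by `n` only if there is a solution.
module _ {S : Set} {α β : Fin 2} (α≢β : α ≢ β) (χ : ℕ → Fin 2)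
  {a b n W P : ℕ} (0<a : 0 < a) (0<b : 0 < b)
  (coab : Coprime a b) (cona : Coprime n a) (conb : Coprime n b) (2∤n : ¬ (2 ℕ.∣ n))
  (W-large : a * ((2 + b) * n) ≤ W) (P-large : 2 * (a + b) * W ≤ P)
  (step : ∀ X → 0 < X → a * X < P → χ X ≡ α → χ (X + n) ≡ β → S)
  (P-mono : ∀ X Y → 0 < X → 0 < Y → a * X + b * Y ≡ P → χ X ≡ α → χ Y ≡ α → S)
  (W-mono : ∀ X Y → 0 < X → 0 < Y → a * X + b * Y ≡ W → χ X ≡ β → χ Y ≡ β → S)
  where

  private
    0<n : 0 < n
    0<n = n≢0⇒n>0 λ { refl → 2∤n (ℕ.divides 0 refl) }

    instance
      n≢0 : NonZero n
      n≢0 = >-nonZero 0<n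
      a≢0 : NonZero a
      a≢0 = >-nonZero 0<a
      b≢0 : NonZero b
      b≢0 = >-nonZero 0<b

    -- Propagation of `α` read backwards: a `β` at the end means that one of the `i` steps goes from
    -- `α` to `β`. That step starts at least `n` below the end, whence the strict inequality that
    -- `step` requires.
    propagate : ∀ i X → 0 < X → a * (X + i * n) ≤ P → χ X ≡ α → χ (X + i * n) ≡ β → S
    propagate zero X 0<X _ Xα Xβ =
      contradiction (trans (sym Xα) (trans (cong χ (sym (+-identityʳ X))) Xβ)) α≢β
    propagate (suc i) X 0<X le Xα Xβ with two-colours α≢β (χ (X + i * n))
    ... | inj₂ X′β = propagate i X 0<X (≤-trans (*-monoʳ-≤ a (+-monoʳ-≤ X (m≤n+m (i * n) n))) le) Xα X′β
    ... | inj₁ X′α = step (X + i * n) (≤-trans 0<X (m≤m+n X _))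
                       (<-≤-trans (*-monoʳ-< a (subst (X + i * n <_) X″≡ (m<m+n _ 0<n))) le)
                       X′α (trans (cong χ X″≡) Xβ)
      where
      X″≡ : X + i * n + n ≡ X + (n + i * n)
      X″≡ = trans (+-assoc X (i * n) n) (cong (λ w → X + w) (+-comm (i * n) n))

    -- Each residue class is tested at its representative in [h n, (h+1) n).
    h : ℕ
    h = W / n

    hn≤W : h * n ≤ W
    hn≤W = m/n*n≤m W n

    top : Fin n → ℕ
    top r = toℕ r + h * n

    2+b≤h : 2 + b ≤ h
    2+b≤h = subst (_≤ h) (m*n/n≡m (2 + b) n)
      (/-mono-≤ (≤-trans (m≤n*m ((2 + b) * n) a) W-large) (≤-refl {n}))

    top-positive : ∀ r → 0 < top r
    top-positive r = <-≤-trans (*-mono-< (≤-trans (s≤s z≤n) 2+b≤h) 0<n) (m≤n+m (h * n) (toℕ r))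

    rise : ∀ r {j j′} → j ≤ j′ → 0 < r + j * n → a * (r + j′ * n) ≤ P →
      χ (r + j * n) ≡ α → χ (r + j′ * n) ≡ β → S
    rise r {j} j≤j′ pos le jα j′β with m≤n⇒∃[o]m+o≡n j≤j′
    ... | i , refl = propagate i (r + j * n) pos (subst (λ x → a * x ≤ P) eq le) jα (trans (cong χ (sym eq)) j′β)
      where
      rearrange : ∀ r j i n → r + (j + i) * n ≡ r + j * n + i * n
      rearrange = solve-∀
      eq : r + (j + i) * n ≡ r + j * n + i * n
      eq = rearrange r j i n

    n≤W : n ≤ W
    n≤W = ≤-trans (m≤n*m n (2 + b)) (≤-trans (m≤n*m _ a) W-large)

    r≤n : (r : Fin n) → toℕ r ≤ n
    r≤n r = <⇒≤ (Fin.toℕ<n r)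

    -- The summand `n` keeps the first unknown positive when `r` is zero. As `1 + i ≤ b ≤ h`, this
    -- unknown stays at or below `top r`.
    low-sol : (r : Fin n) → ∃₂ λ i Y → i < b × a * (toℕ r + n + i * n) + b * Y ≡ W
    low-sol r = offset-solution (toℕ r + n) n coab conb 0<b
      (≤-trans (*-monoʳ-≤ a (≤-trans (+-monoˡ-≤ (b * n) (+-monoˡ-≤ n (r≤n r))) (≤-reflexive (+-assoc n n (b * n))))) W-large)

    high≤2W : (r : Fin n) → top r + a * n ≤ 2 * W
    high≤2W r = begin
      toℕ r + h * n + a * n          ≤⟨ +-monoˡ-≤ (a * n) (+-mono-≤ (r≤n r) hn≤W) ⟩
      n + W + a * n                  ≤⟨ ≤-from (a * b * n) (+-mono-≤ W-large (m≤n*m n a)) (rearrange a b n W) ⟩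
      2 * W                          ∎
      where
      open ≤-Reasoning
      rearrange : ∀ a b n W → n + W + a * n + (W + a * n) + a * b * n ≡ 2 * W + (a * ((2 + b) * n) + n)
      rearrange = solve-∀

    a-high≤P : ∀ x → x ≤ 2 * W → a * x ≤ P
    a-high≤P x x≤ = ≤-from (2 * b * W) (+-mono-≤ (*-monoʳ-≤ a x≤) P-large) (rearrange a b W P (a * x))
      where
      rearrange : ∀ a b W P t → t + (a * (2 * W) + P) + 2 * b * W ≡ P + (t + 2 * (a + b) * W)
      rearrange = solve-∀

    a-top≤P : ∀ r → a * top r ≤ P
    a-top≤P r = a-high≤P (top r) (≤-trans (m≤m+n (top r) (a * n)) (high≤2W r))

    -- For `Y ≤ 2 * W` the equation `b * Y + a * X ≡ P` leaves `a * X ≥ 2 * a * W`, which puts `X`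
    -- above the test height of its class.
    b-high≤P : ∀ x → x ≤ 2 * W → b * x + 2 * a * W ≤ P
    b-high≤P x x≤ = ≤-from 0 (+-mono-≤ (*-monoʳ-≤ b x≤) P-large) (rearrange a b W P (b * x))
      where
      rearrange : ∀ a b W P t → t + 2 * a * W + (b * (2 * W) + P) + 0 ≡ P + (t + 2 * (a + b) * W)
      rearrange = solve-∀

    high-sol : (r : Fin n) → ∃₂ λ i X → i < a × b * (top r + i * n) + a * X ≡ P
    high-sol r = offset-solution (top r) n (coprime-sym coab) cona 0<a
      (≤-trans (m≤m+n _ _) (b-high≤P _ (high≤2W r)))

    -- If `Y` and `Y′` agree modulo `n`, then `A * r ≡ A * r′` modulo `n`, and `A` is invertible
    -- there. The offset `c` is 1 for `φ` and `h` for `ψ`.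
    residue-injective : ∀ A B {Q c s s′ y} → Coprime n A → (r r′ : Fin n) → ∀ i i′ {Y Y′} →
      s ≡ toℕ r + c * n → s′ ≡ toℕ r′ + c * n →
      A * (s + i * n) + B * Y ≡ Q → A * (s′ + i′ * n) + B * Y′ ≡ Q →
      Y % n ≡ y → Y′ % n ≡ y → r ≡ r′
    residue-injective A B {Q} {c} {y = y} co r r′ i i′ {Y} {Y′} refl refl eq eq′ Y≡ Y′≡ =
      Fin.toℕ-injective (residue-unique co (Fin.toℕ<n r) (Fin.toℕ<n r′)
        (+-cancelʳ-≡ (B * y) _ _ (trans (split (toℕ r) i Y Y≡ eq) (sym (split (toℕ r′) i′ Y′ Y′≡ eq′)))))
      where
      rearrange : ∀ A B c r i n y q → A * r + n * (A * (c + i) + B * q) + B * y ≡ A * (r + c * n + i * n) + B * (y + q * n)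
      rearrange = solve-∀
      split : ∀ r i Y → Y % n ≡ y → A * (r + c * n + i * n) + B * Y ≡ Q →
        A * r + n * (A * (c + i) + B * (Y / n)) + B * y ≡ Q
      split r i Y Y≡ eq = trans (rearrange A B c r i n y (Y / n))
        (trans (cong (λ w → A * (r + c * n + i * n) + B * w)
                 (trans (cong (_+ Y / n * n) (sym Y≡)) (sym (m≡m%n+[m/n]*n Y n)))) eq)

    residue : ℕ → Fin n
    residue Y = fromℕ< (m%n<n Y n)

    residue-% : ∀ Y → Y % n ≡ toℕ (residue Y)
    residue-% Y = sym (Fin.toℕ-fromℕ< (m%n<n Y n))

    residue-split : ∀ Y → Y ≡ toℕ (residue Y) + Y / n * n
    residue-split Y = trans (m≡m%n+[m/n]*n Y n) (cong (_+ Y / n * n) (residue-% Y))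

    low-shift low-Y high-shift high-X : Fin n → ℕ
    low-shift r  = proj₁ (low-sol r)
    low-Y r      = proj₁ (proj₂ (low-sol r))
    high-shift r = proj₁ (high-sol r)
    high-X r     = proj₁ (proj₂ (high-sol r))

    low-eq : ∀ r → a * (toℕ r + n + low-shift r * n) + b * low-Y r ≡ W
    low-eq r = proj₂ (proj₂ (proj₂ (low-sol r)))

    high-eq : ∀ r → b * (top r + high-shift r * n) + a * high-X r ≡ P
    high-eq r = proj₂ (proj₂ (proj₂ (high-sol r)))

    φ ψ : Fin n → Fin n
    φ r = residue (low-Y r)
    ψ r = residue (high-X r)

    φ-injective : ∀ {r r′} → φ r ≡ φ r′ → r ≡ r′
    φ-injective {r} {r′} eq = residue-injective a b {c = 1} cona r r′ (low-shift r) (low-shift r′)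
        (1n r) (1n r′) (low-eq r) (low-eq r′) (trans (residue-% _) (cong toℕ eq)) (residue-% _)
      where
      1n : (r : Fin n) → toℕ r + n ≡ toℕ r + 1 * n
      1n r = cong (λ w → toℕ r + w) (sym (*-identityˡ n))

    ψ-injective : ∀ {r r′} → ψ r ≡ ψ r′ → r ≡ r′
    ψ-injective {r} {r′} eq = residue-injective b a {c = h} conb r r′ (high-shift r) (high-shift r′)
        refl refl (high-eq r) (high-eq r′) (trans (residue-% _) (cong toℕ eq)) (residue-% _)

    -- `X` and `Y` lie at or below the test points of their classes. An `α` on either would have to
    -- rise to the `β` at that point, so both are `β` and `W-mono` applies.
    β-swap : ∀ r i Y → i < b → a * (toℕ r + n + i * n) + b * Y ≡ W →
      χ (top r) ≡ β → χ (top (residue Y)) ≡ β → S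
    β-swap r i Y i<b eq rβ r′β = by-cases (two-colours α≢β (χ X)) (two-colours α≢β (χ Y))
      where
      X = toℕ r + n + i * n
      X<W′ : a * X < W
      X<W′ = <-≤-trans (*-monoʳ-< a X<) W-large
        where
        X< : X < (2 + b) * n
        X< = begin-strict
          toℕ r + n + i * n  <⟨ +-mono-<-≤ (+-monoˡ-< n (Fin.toℕ<n r)) (*-monoˡ-≤ n (<⇒≤ i<b)) ⟩
          n + n + b * n      ≡⟨ +-assoc n n (b * n) ⟩
          (2 + b) * n        ∎
          where open ≤-Reasoning
      0<Y : 0 < Y
      0<Y = n≢0⇒n>0 λ { refl → <-irrefl (trans (sym (trans (cong (λ w → a * X + w) (*-zeroʳ b)) (+-identityʳ _))) eq) X<W′ }
      Y≤W : Y ≤ W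
      Y≤W = ≤-trans (m≤n*m Y b) (≤-trans (m≤n+m (b * Y) (a * X)) (≤-reflexive eq))
      by-cases : (χ X ≡ α) ⊎ (χ X ≡ β) → (χ Y ≡ α) ⊎ (χ Y ≡ β) → S
      by-cases (inj₁ Xα) _ = rise (toℕ r) {1 + i} {h} (≤-trans (m≤n⇒m≤1+n i<b) (≤-trans (n≤1+n _) 2+b≤h))
        (<-≤-trans 0<n (≤-trans (m≤m+n n (i * n)) (m≤n+m _ (toℕ r)))) (a-top≤P r)
        (trans (cong χ (sym (+-assoc (toℕ r) n (i * n)))) Xα) rβ
      by-cases (inj₂ Xβ) (inj₂ Yβ) = W-mono X Y (<-≤-trans 0<n (≤-trans (m≤n+m n (toℕ r)) (m≤m+n _ (i * n)))) 0<Y eq Xβ Yβ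
      by-cases (inj₂ Xβ) (inj₁ Yα) = rise (toℕ (residue Y)) {Y / n} {h} (/-mono-≤ Y≤W ≤-refl)
        (subst (0 <_) (residue-split Y) 0<Y) (a-top≤P (residue Y))
        (trans (cong χ (sym (residue-split Y))) Yα) r′β

    -- The mirror image of `β-swap`: `Y` and `X` lie at or above the test points, from which `α` has
    -- to rise to them, and `P-mono` applies.
    α-swap : ∀ r i X → i < a → b * (top r + i * n) + a * X ≡ P →
      χ (top r) ≡ α → χ (top (residue X)) ≡ α → S
    α-swap r i X i<a eq rα r′α = by-cases (two-colours α≢β (χ Y)) (two-colours α≢β (χ X))
      where
      Y = top r + i * n
      Y≡ : Y ≡ toℕ r + (h + i) * n
      Y≡ = rearrange (toℕ r) h i n
        where
        rearrange : ∀ r h i n → r + h * n + i * n ≡ r + (h + i) * n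
        rearrange = solve-∀
      Y≤2W : Y ≤ 2 * W
      Y≤2W = ≤-trans (+-monoʳ-≤ (top r) (*-monoˡ-≤ n (<⇒≤ i<a))) (high≤2W r)
      aX≤P : a * X ≤ P
      aX≤P = ≤-trans (m≤n+m (a * X) (b * Y)) (≤-reflexive eq)
      W≤X : W ≤ X
      W≤X = ≤-trans (m≤m+n W (W + 0)) (*-cancelˡ-≤ a (≤-from 0
        (≤-trans (b-high≤P Y Y≤2W) (≤-reflexive (sym eq))) (rearrange a W (b * Y) (a * X))))
        where
        rearrange : ∀ a W t x → a * (2 * W) + (t + x) + 0 ≡ x + (t + 2 * a * W)
        rearrange = solve-∀
      by-cases : (χ Y ≡ α) ⊎ (χ Y ≡ β) → (χ X ≡ α) ⊎ (χ X ≡ β) → S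
      by-cases (inj₂ Yβ) _ = rise (toℕ r) {h} {h + i} (m≤m+n h i) (top-positive r)
        (subst (λ y → a * y ≤ P) Y≡ (a-high≤P Y Y≤2W)) rα (trans (cong χ (sym Y≡)) Yβ)
      by-cases (inj₁ Yα) (inj₁ Xα) = P-mono X Y (<-≤-trans 0<n (≤-trans n≤W W≤X))
        (≤-trans (top-positive r) (m≤m+n _ _)) (trans (+-comm (a * X) _) eq) Xα Yα
      by-cases (inj₁ Yα) (inj₂ Xβ) = rise (toℕ (residue X)) {h} {X / n} (/-mono-≤ W≤X ≤-refl)
        (top-positive (residue X)) (subst (λ x → a * x ≤ P) (residue-split X) aX≤P) r′α
        (trans (cong χ (sym (residue-split X))) Xβ)

    low-bound : ∀ r → low-shift r < b
    low-bound r = proj₁ (proj₂ (proj₂ (low-sol r)))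

    high-bound : ∀ r → high-shift r < a
    high-bound r = proj₁ (proj₂ (proj₂ (high-sol r)))

    conclude : (∃ λ r → χ (top r) ≡ β × χ (top (φ r)) ≡ β) ⊎ (∃ λ r → χ (top r) ≡ α × χ (top (ψ r)) ≡ α) → S
    conclude (inj₁ (r , rβ , φrβ)) = β-swap r (low-shift r) (low-Y r) (low-bound r) (low-eq r) rβ φrβ
    conclude (inj₂ (r , rα , ψrα)) = α-swap r (high-shift r) (high-X r) (high-bound r) (high-eq r) rα ψrα

  odd-modulus-forces-solution : S
  odd-modulus-forces-solution =
    -- The colours are exchanged here, since `φ` is the map that sends `β` to `α`.
    conclude (odd-no-swap 2∤n (α≢β ∘ sym) (χ ∘ top) φ ψ φ-injective ψ-injective)

-- Growth of polynomials

Eventually : (ℕ → Set) → Set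
Eventually P = ∃ λ N → ∀ n → N ≤ n → P n

infixr 4 _∧_
_∧_ : ∀ {P Q : ℕ → Set} → Eventually P → Eventually Q → Eventually (λ n → P n × Q n)
(M , p) ∧ (N , q) = M + N , λ n le → p n (≤-trans (m≤m+n M N) le) , q n (≤-trans (m≤n+m N M) le)

eventually-map : ∀ {P Q : ℕ → Set} → (∀ n → P n → Q n) → Eventually P → Eventually Q
eventually-map f (N , p) = N , λ n N≤n → f n (p n N≤n)

at-least : ∀ m → Eventually (m ≤_)
at-least m = m , λ _ le → le

onwards : ∀ {P} → Eventually P → Eventually (λ n → ∀ k → n ≤ k → P k)
onwards (N , p) = N , λ n N≤n k n≤k → p k (≤-trans N≤n n≤k)

^-distribʳ-* : ∀ n x y → (x * y) ^ n ≡ x ^ n * y ^ n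
^-distribʳ-* zero    x y = refl
^-distribʳ-* (suc n) x y = trans (cong (x * y *_) (^-distribʳ-* n x y)) (rearrange x y (x ^ n) (y ^ n))
  where
  rearrange : ∀ x y s t → x * y * (s * t) ≡ x * s * (y * t)
  rearrange = solve-∀

coefficient-sum : List ℤ → ℕ
coefficient-sum []       = 0
coefficient-sum (c ∷ cs) = ∣ c ∣ + coefficient-sum cs

-- The bound of order `length cs - 1` is multiplied by `z`, which avoids a truncated exponent and
-- covers the empty list.
eval-bound : ∀ cs z → 0 < z → z * ∣ eval cs (+ z) ∣ ≤ coefficient-sum cs * z ^ length cs
eval-bound []       z 0<z = ≤-reflexive (*-zeroʳ z)
eval-bound (c ∷ cs) z 0<z = begin
  z * ∣ c ℤ.+ + z ℤ.* e ∣                  ≤⟨ *-monoʳ-≤ z (ℤ.∣i+j∣≤∣i∣+∣j∣ c (+ z ℤ.* e)) ⟩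
  z * (∣ c ∣ + ∣ + z ℤ.* e ∣)              ≡⟨ cong (λ t → z * (∣ c ∣ + t)) (ℤ.abs-* (+ z) e) ⟩
  z * (∣ c ∣ + z * ∣ e ∣)                  ≤⟨ *-monoʳ-≤ z (+-mono-≤ (m≤m*n ∣ c ∣ (z ^ length cs)) (eval-bound cs z 0<z)) ⟩
  z * (∣ c ∣ * z ^ length cs + coefficient-sum cs * z ^ length cs) ≡⟨ rearrange z ∣ c ∣ (coefficient-sum cs) (z ^ length cs) ⟩
  (∣ c ∣ + coefficient-sum cs) * (z * z ^ length cs) ∎
  where
  open ≤-Reasoning
  e = eval cs (+ z)
  instance
    z^≢0 : NonZero (z ^ length cs)
    z^≢0 = m^n≢0 z (length cs) {{>-nonZero 0<z}}
  rearrange : ∀ z c s t → z * (c * t + s * t) ≡ (c + s) * (z * t)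
  rearrange = solve-∀

module _ (d : ℕ) where

  difference : List ℤ → ℕ → ℤ
  difference cs k = eval cs (+ (k + d)) ℤ.- eval cs (+ k)

  -- This is `d` times the sum of `i * ∣ cᵢ ∣`, that is, `d` times the coefficient sum of the formal
  -- derivative.
  difference-sum : List ℤ → ℕ
  difference-sum []       = 0
  difference-sum (c ∷ cs) = d * coefficient-sum cs + difference-sum cs

  -- The discrete product rule for `z * eval cs z`; the constant `c` cancels.
  difference-∷ : ∀ c cs k → difference (c ∷ cs) k ≡ + d ℤ.* eval cs (+ (k + d)) ℤ.+ + k ℤ.* difference cs k
  difference-∷ c cs k = rearrange c (+ k) (+ d) (eval cs (+ (k + d))) (eval cs (+ k))
    where
    rearrange : ∀ c k d e f → c ℤ.+ (k ℤ.+ d) ℤ.* e ℤ.- (c ℤ.+ k ℤ.* f) ≡ d ℤ.* e ℤ.+ k ℤ.* (e ℤ.- f)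
    rearrange = ℤ.solve-∀

  -- A difference has one degree less than the polynomial, hence a second factor `k + d` compared
  -- with `eval-bound`.
  difference-bound : ∀ cs k → 0 < k →
    (k + d) * ((k + d) * ∣ difference cs k ∣) ≤ difference-sum cs * (k + d) ^ length cs
  difference-bound []       k 0<k = ≤-reflexive (trans (cong ((k + d) *_) (*-zeroʳ (k + d))) (*-zeroʳ (k + d)))
  difference-bound (c ∷ cs) k 0<k = begin
    w * (w * ∣ difference (c ∷ cs) k ∣)     ≤⟨ *-monoʳ-≤ w (*-monoʳ-≤ w abs≤) ⟩
    w * (w * (d * E + w * Δ))               ≡⟨ rearrange w d E Δ ⟩
    w * (d * (w * E) + w * (w * Δ))         ≤⟨ *-monoʳ-≤ w (+-mono-≤ (*-monoʳ-≤ d (eval-bound cs w (≤-trans 0<k (m≤m+n k d))))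
                                                                      (difference-bound cs k 0<k)) ⟩
    w * (d * (coefficient-sum cs * w ^ length cs) + difference-sum cs * w ^ length cs)
                                            ≡⟨ rearrange′ w d (coefficient-sum cs) (difference-sum cs) (w ^ length cs) ⟩
    difference-sum (c ∷ cs) * (w * w ^ length cs) ∎
    where
    open ≤-Reasoning
    w = k + d
    E = ∣ eval cs (+ w) ∣
    Δ = ∣ difference cs k ∣
    abs≤ : ∣ difference (c ∷ cs) k ∣ ≤ d * E + w * Δ
    abs≤ = begin
      ∣ difference (c ∷ cs) k ∣                                    ≡⟨ cong ∣_∣ (difference-∷ c cs k) ⟩
      ∣ + d ℤ.* eval cs (+ w) ℤ.+ + k ℤ.* difference cs k ∣        ≤⟨ ℤ.∣i+j∣≤∣i∣+∣j∣ (+ d ℤ.* eval cs (+ w)) _ ⟩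
      ∣ + d ℤ.* eval cs (+ w) ∣ + ∣ + k ℤ.* difference cs k ∣      ≡⟨ cong₂ _+_ (ℤ.abs-* (+ d) (eval cs (+ w))) (ℤ.abs-* (+ k) (difference cs k)) ⟩
      d * E + k * Δ                                                ≤⟨ +-monoʳ-≤ (d * E) (*-monoˡ-≤ Δ (m≤m+n k d)) ⟩
      d * E + w * Δ                                                ∎
    rearrange : ∀ w d E Δ → w * (w * (d * E + w * Δ)) ≡ w * (d * (w * E) + w * (w * Δ))
    rearrange = solve-∀
    rearrange′ : ∀ w d s t x → w * (d * (s * x) + t * x) ≡ (d * s + t) * (w * x)
    rearrange′ = solve-∀

eval-snoc : ∀ cs l z → eval (cs ++ l ∷ []) (+ z) ≡ eval cs (+ z) ℤ.+ + (z ^ length cs) ℤ.* l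
eval-snoc []       l z = rearrange l (+ z)
  where
  rearrange : ∀ l z → l ℤ.+ z ℤ.* 0ℤ ≡ 0ℤ ℤ.+ (+ 1) ℤ.* l
  rearrange = ℤ.solve-∀
eval-snoc (c ∷ cs) l z = begin
  c ℤ.+ + z ℤ.* eval (cs ++ l ∷ []) (+ z)        ≡⟨ cong (λ e → c ℤ.+ + z ℤ.* e) (eval-snoc cs l z) ⟩
  c ℤ.+ + z ℤ.* (eval cs (+ z) ℤ.+ + t ℤ.* l)    ≡⟨ rearrange c (+ z) (eval cs (+ z)) (+ t) l ⟩
  c ℤ.+ + z ℤ.* eval cs (+ z) ℤ.+ + z ℤ.* + t ℤ.* l  ≡⟨ cong (λ e → c ℤ.+ + z ℤ.* eval cs (+ z) ℤ.+ e ℤ.* l) (ℤ.pos-* z t) ⟨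
  c ℤ.+ + z ℤ.* eval cs (+ z) ℤ.+ + (z * t) ℤ.* l  ∎
  where
  open ≡-Reasoning
  t = z ^ length cs
  rearrange : ∀ c z e t l → c ℤ.+ z ℤ.* (e ℤ.+ t ℤ.* l) ≡ c ℤ.+ z ℤ.* e ℤ.+ z ℤ.* t ℤ.* l
  rearrange = ℤ.solve-∀

i+∣i∣-nonneg : ∀ i → ∃ λ n → i ℤ.+ + ∣ i ∣ ≡ + n
i+∣i∣-nonneg (+ n)    = n + n , refl
i+∣i∣-nonneg -[1+ n ] = 0 , ℤ.n⊖n≡0 (suc n)

module _ {l : ℤ} (0<l : 0ℤ ℤ.< l) where

  private
    _⊕l : List ℤ → List ℤ
    cs ⊕l = cs ++ l ∷ []

  -- Induction along Horner's scheme: once the quotient polynomial is at least 1 and `z` exceeds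
  -- `∣ c ∣`, the value is at least 1. The base case is the leading coefficient.
  eventually-positive : ∀ cs → Eventually λ z → ∃ λ n → eval (cs ⊕l) (+ z) ≡ + suc n
  eventually-positive [] = 0 , λ z _ → base z 0<l
    where
    base : ∀ z {l} → 0ℤ ℤ.< l → ∃ λ n → l ℤ.+ + z ℤ.* 0ℤ ≡ + suc n
    base z {+ suc n} (ℤ.+<+ (s≤s z≤n)) = n , trans (cong (ℤ._+_ (+ suc n)) (ℤ.*-zeroʳ (+ z))) (ℤ.+-identityʳ (+ suc n))
  eventually-positive (c ∷ cs) = eventually-map step (eventually-positive cs ∧ at-least (suc ∣ c ∣))
    where
    step : ∀ z → (∃ λ n → eval (cs ⊕l) (+ z) ≡ + suc n) × suc ∣ c ∣ ≤ z →
      ∃ λ n → c ℤ.+ + z ℤ.* eval (cs ⊕l) (+ z) ≡ + suc n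
    step z ((n , eq) , c<z) with m≤n⇒∃[o]m+o≡n c<z | i+∣i∣-nonneg c
    ... | j , refl | m , eq′ = m + (j + z * n) , (begin
      c ℤ.+ + z ℤ.* eval (cs ⊕l) (+ z)                          ≡⟨ cong (λ e → c ℤ.+ + z ℤ.* e) eq ⟩
      c ℤ.+ + z ℤ.* + suc n                                     ≡⟨ rearrange c (+ ∣ c ∣) (+ j) (+ n) ⟩
      + 1 ℤ.+ (c ℤ.+ + ∣ c ∣ ℤ.+ (+ j ℤ.+ + z ℤ.* + n))         ≡⟨ cong₂ (λ s t → + 1 ℤ.+ (s ℤ.+ (+ j ℤ.+ t))) eq′ (sym (ℤ.pos-* z n)) ⟩
      + suc (m + (j + z * n))                                   ∎)
      where
      open ≡-Reasoning
      rearrange : ∀ c a j n → c ℤ.+ (+ 1 ℤ.+ a ℤ.+ j) ℤ.* (+ 1 ℤ.+ n)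
        ≡ + 1 ℤ.+ (c ℤ.+ a ℤ.+ (j ℤ.+ (+ 1 ℤ.+ a ℤ.+ j) ℤ.* n))
      rearrange = ℤ.solve-∀

  module _ (d : ℕ) where

    private
      -- A lower bound m for the increment of the quotient polynomial gives k m + d for the polynomial itself.
      increment-∷ : ∀ c cs k {m n n′} → eval (cs ⊕l) (+ (k + d)) ≡ eval (cs ⊕l) (+ k) ℤ.+ + (m + n) →
        eval (cs ⊕l) (+ (k + d)) ≡ + suc n′ →
        eval (c ∷ cs ⊕l) (+ (k + d)) ≡ eval (c ∷ cs ⊕l) (+ k) ℤ.+ + (k * m + d + (k * n + d * n′))
      increment-∷ c cs k {m} {n} {n′} inc pos = begin
        c ℤ.+ + (k + d) ℤ.* q′                                     ≡⟨ split c (+ k) (+ d) q′ ⟩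
        c ℤ.+ + k ℤ.* q′ ℤ.+ + d ℤ.* q′                            ≡⟨ cong₂ (λ s t → c ℤ.+ + k ℤ.* s ℤ.+ + d ℤ.* t) inc pos ⟩
        c ℤ.+ + k ℤ.* (q ℤ.+ + (m + n)) ℤ.+ + d ℤ.* + suc n′       ≡⟨ rearrange c (+ k) (+ d) q (+ m) (+ n) (+ n′) ⟩
        c ℤ.+ + k ℤ.* q ℤ.+ (+ k ℤ.* + m ℤ.+ + d ℤ.+ (+ k ℤ.* + n ℤ.+ + d ℤ.* + n′))
          ≡⟨ cong (λ t → c ℤ.+ + k ℤ.* q ℤ.+ t) (cong₂ ℤ._+_ (cong (ℤ._+ + d) (sym (ℤ.pos-* k m))) (cong₂ ℤ._+_ (sym (ℤ.pos-* k n)) (sym (ℤ.pos-* d n′)))) ⟩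
        c ℤ.+ + k ℤ.* q ℤ.+ + (k * m + d + (k * n + d * n′))       ∎
        where
        open ≡-Reasoning
        q = eval (cs ⊕l) (+ k)
        q′ = eval (cs ⊕l) (+ (k + d))
        split : ∀ c k d q → c ℤ.+ (k ℤ.+ d) ℤ.* q ≡ c ℤ.+ k ℤ.* q ℤ.+ d ℤ.* q
        split = ℤ.solve-∀
        rearrange : ∀ c k d q m n n′ → c ℤ.+ k ℤ.* (q ℤ.+ (m ℤ.+ n)) ℤ.+ d ℤ.* (+ 1 ℤ.+ n′)
          ≡ c ℤ.+ k ℤ.* q ℤ.+ (k ℤ.* m ℤ.+ d ℤ.+ (k ℤ.* n ℤ.+ d ℤ.* n′))
        rearrange = ℤ.solve-∀

    -- `f` is an eventual lower bound for the increment over `d`; the surplus `n` keeps it an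
    -- equation of integers.
    Increment : (ℕ → ℕ) → List ℤ → Set
    Increment f cs = Eventually λ k → ∃ λ n → eval (cs ⊕l) (+ (k + d)) ≡ eval (cs ⊕l) (+ k) ℤ.+ + (f k + n)

    increment-step : ∀ f c cs → Increment f cs → Increment (λ k → k * f k + d) (c ∷ cs)
    increment-step f c cs inc = eventually-map
      (λ k ((n , eq) , pos) → let n′ , eq′ = pos (k + d) (m≤m+n k d) in k * n + d * n′ , increment-∷ c cs k eq eq′)
      (inc ∧ onwards (eventually-positive cs))

    increment-≥ : ∀ {f g} cs → (∀ k → g k ≤ f k) → Increment f cs → Increment g cs
    increment-≥ {f} {g} cs g≤f = eventually-map λ k (n , eq) → f k ∸ g k + n , trans eq
      (cong (λ t → eval (cs ⊕l) (+ k) ℤ.+ + t) (trans (cong (_+ n) (sym (m+[n∸m]≡n (g≤f k)))) (+-assoc (g k) _ n)))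

    increment-0 : ∀ cs → Increment (λ _ → 0) cs
    increment-0 [] = 0 , λ k _ → 0 , (rearrange l (+ k) (+ (k + d)))
      where
      rearrange : ∀ l k w → l ℤ.+ w ℤ.* 0ℤ ≡ l ℤ.+ k ℤ.* 0ℤ ℤ.+ 0ℤ
      rearrange = ℤ.solve-∀
    increment-0 (c ∷ cs) = increment-≥ (c ∷ cs) (λ _ → z≤n) (increment-step _ c cs (increment-0 cs))

    -- Two Horner steps turn the trivial bound 0 into `d` and then into `k * d + d`. Degree 1 would
    -- give only a constant.
    increment-k : 0 < d → ∀ cs → 2 ≤ length cs → Increment (λ k → k) cs
    increment-k 0<d (c ∷ c′ ∷ cs) _ = increment-≥ (c ∷ c′ ∷ cs)
      (λ k → ≤-trans (≤-trans (m≤m*n k d) (*-monoʳ-≤ k (m≤n+m d _))) (m≤m+n _ d))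
      (increment-step _ c (c′ ∷ cs) (increment-step _ c′ cs (increment-0 cs)))
      where
      instance
        d≢0 : NonZero d
        d≢0 = >-nonZero 0<d
    increment-k _ (_ ∷ []) (s≤s ())

    module Growth (0<d : 0 < d) (cs : List ℤ) (2≤n : 2 ≤ length cs) where

      p : ℕ → ℕ
      p z = ∣ eval (cs ⊕l) (+ z) ∣

      private
        n = length cs
        Σcs = coefficient-sum cs
        Σp = coefficient-sum (cs ⊕l)
        Δp = difference-sum d (cs ⊕l)

        length-snoc : length (cs ⊕l) ≡ suc n
        length-snoc = trans (length-++ cs) (+-comm n 1)

      p-pos : Eventually λ z → + p z ≡ eval (cs ⊕l) (+ z)
      p-pos = eventually-map (λ z (_ , eq) → trans (cong (λ e → + ∣ e ∣) eq) (sym eq)) (eventually-positive cs)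

      p-increasing : Eventually λ k → p k + k ≤ p (k + d)
      p-increasing = eventually-map step (eventually-positive cs ∧ increment-k 0<d cs 2≤n)
        where
        step : ∀ k → (∃ λ n → eval (cs ⊕l) (+ k) ≡ + suc n) ×
          (∃ λ n → eval (cs ⊕l) (+ (k + d)) ≡ eval (cs ⊕l) (+ k) ℤ.+ + (k + n)) → p k + k ≤ p (k + d)
        step k ((m , eq) , (n , eq′)) = subst₂ (λ s t → ∣ s ∣ + k ≤ ∣ t ∣) (sym eq) (sym (trans eq′ (cong (ℤ._+ + (k + n)) eq)))
          (+-monoʳ-≤ (suc m) (m≤m+n k n))

      -- The leading term is at least `z ^ n`, and the lower terms amount to at most half of `z ^ n`
      -- once `z ≥ 2 * Σcs`.
      p-lower : Eventually λ z → z ^ n ≤ 2 * p z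
      p-lower = eventually-map step (at-least (2 * Σcs) ∧ at-least 1)
        where
        step : ∀ z → 2 * Σcs ≤ z × 1 ≤ z → z ^ n ≤ 2 * p z
        step z (2S≤z , 0<z) = *-cancelˡ-≤ z (≤-from 0
          (+-mono-≤ (*-monoʳ-≤ (2 * z) z^n≤) (+-mono-≤ (*-monoʳ-≤ 2 (eval-bound cs z 0<z)) (*-monoˡ-≤ (z ^ n) 2S≤z)))
          (rearrange z (z ^ n) (p z) ∣ eval cs (+ z) ∣ Σcs))
          where
          instance
            z≢0 : NonZero z
            z≢0 = >-nonZero 0<z
            ∣l∣≢0 : NonZero ∣ l ∣
            ∣l∣≢0 = positive 0<l
              where
              positive : ∀ {l} → 0ℤ ℤ.< l → NonZero ∣ l ∣
              positive (ℤ.+<+ (s≤s z≤n)) = _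
          z^n≤ : z ^ n ≤ p z + ∣ eval cs (+ z) ∣
          z^n≤ = begin
            z ^ n                                              ≤⟨ m≤m*n (z ^ n) ∣ l ∣ ⟩
            z ^ n * ∣ l ∣                                      ≡⟨ ℤ.abs-* (+ (z ^ n)) l ⟨
            ∣ + (z ^ n) ℤ.* l ∣                                ≡⟨ cong ∣_∣ (cancel (eval cs (+ z)) (+ (z ^ n) ℤ.* l)) ⟨
            ∣ eval cs (+ z) ℤ.+ + (z ^ n) ℤ.* l ℤ.- eval cs (+ z) ∣  ≡⟨ cong (λ e → ∣ e ℤ.- eval cs (+ z) ∣) (eval-snoc cs l z) ⟨
            ∣ eval (cs ⊕l) (+ z) ℤ.- eval cs (+ z) ∣           ≤⟨ ℤ.∣i-j∣≤∣i∣+∣j∣ (eval (cs ⊕l) (+ z)) (eval cs (+ z)) ⟩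
            p z + ∣ eval cs (+ z) ∣                            ∎
            where
            open ≤-Reasoning
            cancel : ∀ x y → x ℤ.+ y ℤ.- x ≡ y
            cancel = ℤ.solve-∀
          rearrange : ∀ z t p e S → z * t + (2 * z * (p + e) + (2 * (S * t) + z * t)) + 0
            ≡ z * (2 * p) + (2 * z * t + (2 * (z * e) + 2 * S * t))
          rearrange = solve-∀

      p-unbounded : ∀ M → Eventually λ z → M ≤ p z
      p-unbounded M = eventually-map step (p-lower ∧ at-least (2 * M) ∧ at-least 1)
        where
        step : ∀ z → z ^ n ≤ 2 * p z × 2 * M ≤ z × 1 ≤ z → M ≤ p z
        step z@(suc _) (lower , 2M≤z , _) = *-cancelˡ-≤ 2 (begin
          2 * M    ≤⟨ 2M≤z ⟩
          z        ≡⟨ *-identityʳ z ⟨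
          z ^ 1    ≤⟨ ^-monoʳ-≤ z (≤-trans (s≤s z≤n) 2≤n) ⟩
          z ^ n    ≤⟨ lower ⟩
          2 * p z  ∎)
          where open ≤-Reasoning

      p-upper : ∀ z → 0 < z → p z ≤ Σp * z ^ n
      p-upper z 0<z = *-cancelˡ-≤ z {{>-nonZero 0<z}} (begin
        z * p z                     ≤⟨ eval-bound (cs ⊕l) z 0<z ⟩
        Σp * z ^ length (cs ⊕l)     ≡⟨ cong (λ m → Σp * z ^ m) length-snoc ⟩
        Σp * (z * z ^ n)            ≡⟨ rearrange Σp z (z ^ n) ⟩
        z * (Σp * z ^ n)            ∎)
        where
        open ≤-Reasoning
        rearrange : ∀ S z t → S * (z * t) ≡ z * (S * t)
        rearrange = solve-∀

      p-fast : ∀ C → ∃ λ E → Eventually λ z → ∀ k → E * z ≤ k → C * p z ≤ p k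
      p-fast C = E , eventually-map step (onwards p-lower ∧ at-least 1)
        where
        -- `Σp` comes from `p-upper` and the factor 2 from `p-lower`; `E ≤ E ^ n` lets a linear `E`
        -- suffice.
        E = suc (2 * C * Σp)
        step : ∀ z → (∀ k → z ≤ k → k ^ n ≤ 2 * p k) × 1 ≤ z → ∀ k → E * z ≤ k → C * p z ≤ p k
        step z (lower , 0<z) k Ez≤k = *-cancelˡ-≤ 2 (begin
          2 * (C * p z)              ≤⟨ *-monoʳ-≤ 2 (*-monoʳ-≤ C (p-upper z 0<z)) ⟩
          2 * (C * (Σp * z ^ n))     ≡⟨ rearrange C Σp (z ^ n) ⟩
          2 * C * Σp * z ^ n         ≤⟨ *-monoˡ-≤ (z ^ n) (≤-trans (n≤1+n _) E≤E^n) ⟩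
          E ^ n * z ^ n              ≡⟨ ^-distribʳ-* n E z ⟨
          (E * z) ^ n                ≤⟨ ^-monoˡ-≤ n Ez≤k ⟩
          k ^ n                      ≤⟨ lower k (≤-trans (m≤n*m z E) Ez≤k) ⟩
          2 * p k                    ∎)
          where
          open ≤-Reasoning
          E≤E^n : E ≤ E ^ n
          E≤E^n = ≤-trans (≤-reflexive (sym (*-identityʳ E))) (^-monoʳ-≤ E {1} (≤-trans (s≤s z≤n) 2≤n))
          rearrange : ∀ C S t → 2 * (C * (S * t)) ≡ 2 * C * S * t
          rearrange = solve-∀

      -- The increment at `k` has order `k ^ (n - 1)`. With `k ≤ F * z` this is of smaller order
      -- than `z ^ n`, which `p-lower` compares with `p z`.
      p-slow : ∀ C F → Eventually λ z → ∀ k → z ≤ k → k ≤ F * z → C * p (k + d) ≤ C * p k + p z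
      p-slow C F = eventually-map step (p-lower ∧ at-least 1 ∧ at-least (2 * C * Δp * (F + d) ^ n))
        where
        step : ∀ z → z ^ n ≤ 2 * p z × 1 ≤ z × 2 * C * Δp * (F + d) ^ n ≤ z →
          ∀ k → z ≤ k → k ≤ F * z → C * p (k + d) ≤ C * p k + p z
        step z (lower , 0<z , large) k z≤k k≤Fz = ≤-from 0
          (+-mono-≤ (*-monoʳ-≤ C p[k+d]≤) CΔ≤) (rearrange C (p (k + d)) (p k) (p z) Δ)
          where
          w = k + d
          0<k = ≤-trans 0<z z≤k
          Δ = ∣ difference d (cs ⊕l) k ∣
          instance
            w≢0 : NonZero w
            w≢0 = >-nonZero (≤-trans 0<k (m≤m+n k d))
          p[k+d]≤ : p w ≤ p k + Δ
          p[k+d]≤ = begin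
            p w                                                  ≡⟨ cong ∣_∣ (cancel (eval (cs ⊕l) (+ k)) (eval (cs ⊕l) (+ w))) ⟩
            ∣ eval (cs ⊕l) (+ k) ℤ.+ difference d (cs ⊕l) k ∣    ≤⟨ ℤ.∣i+j∣≤∣i∣+∣j∣ (eval (cs ⊕l) (+ k)) _ ⟩
            p k + Δ                                              ∎
            where
            open ≤-Reasoning
            cancel : ∀ x y → y ≡ x ℤ.+ (y ℤ.- x)
            cancel = ℤ.solve-∀
          wΔ≤ : w * Δ ≤ Δp * w ^ n
          wΔ≤ = *-cancelˡ-≤ w (begin
            w * (w * Δ)                 ≤⟨ difference-bound d (cs ⊕l) k 0<k ⟩
            Δp * w ^ length (cs ⊕l)     ≡⟨ cong (λ m → Δp * w ^ m) length-snoc ⟩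
            Δp * (w * w ^ n)            ≡⟨ reorder Δp w (w ^ n) ⟩
            w * (Δp * w ^ n)            ∎)
            where
            open ≤-Reasoning
            reorder : ∀ S z t → S * (z * t) ≡ z * (S * t)
            reorder = solve-∀
          w≤[F+d]z : w ≤ (F + d) * z
          w≤[F+d]z = ≤-trans (+-mono-≤ k≤Fz (m≤m*n d z {{>-nonZero 0<z}})) (≤-reflexive (sym (*-distribʳ-+ z F d)))
          CΔ≤ : C * Δ ≤ p z
          CΔ≤ = *-cancelˡ-≤ w (begin
            w * (C * Δ)                              ≡⟨ reorder₁ w C Δ ⟩
            C * (w * Δ)                              ≤⟨ *-monoʳ-≤ C wΔ≤ ⟩
            C * (Δp * w ^ n)                         ≤⟨ *-monoʳ-≤ C (*-monoʳ-≤ Δp (^-monoˡ-≤ n w≤[F+d]z)) ⟩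
            C * (Δp * ((F + d) * z) ^ n)             ≡⟨ cong (λ t → C * (Δp * t)) (^-distribʳ-* n (F + d) z) ⟩
            C * (Δp * ((F + d) ^ n * z ^ n))         ≤⟨ *-monoʳ-≤ C (*-monoʳ-≤ Δp (*-monoʳ-≤ ((F + d) ^ n) lower)) ⟩
            C * (Δp * ((F + d) ^ n * (2 * p z)))     ≡⟨ reorder₂ C Δp ((F + d) ^ n) (p z) ⟩
            2 * C * Δp * (F + d) ^ n * p z           ≤⟨ *-monoˡ-≤ (p z) (≤-trans large (≤-trans z≤k (m≤m+n k d))) ⟩
            w * p z                                  ∎)
            where
            open ≤-Reasoning
            reorder₁ : ∀ w C x → w * (C * x) ≡ C * (w * x)
            reorder₁ = solve-∀
            reorder₂ : ∀ C S t p → C * (S * (t * (2 * p))) ≡ 2 * C * S * t * p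
            reorder₂ = solve-∀
          rearrange : ∀ C x y z Δ → C * x + (C * (y + Δ) + z) + 0 ≡ C * y + z + (C * x + C * Δ)
          rearrange = solve-∀

-- Switches on the class of t

module Switches {S : Set} (c : ℕ → Fin 2) {a b d u t₀ v₀ : ℕ} (p : ℕ → ℕ) (K₀ : ℕ)
  (0<a : 0 < a) (0<b : 0 < b) (0<u : 0 < u) (v₀<u : v₀ < u) (coab : Coprime a b)
  (mono : ∀ γ x y z → K₀ ≤ z → 0 < x → 0 < y → a * x + b * y ≡ p z →
    c x ≡ γ → c y ≡ γ → c z ≡ γ → S)
  (p-step : ∀ κ → K₀ ≤ t₀ + d * κ →
    ∃ λ m → p (t₀ + d * κ + d) ≡ p (t₀ + d * κ) + a * (u * m) × ¬ (2 ℕ.∣ m) × Coprime m a × Coprime m b)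
  (p-v-mod-u : ∀ ζ → K₀ ≤ v₀ + u * ζ → ∃ λ W → p (v₀ + u * ζ) ≡ (a + b) * v₀ + u * W)
  (p-t-mod-u : ∀ κ → K₀ ≤ t₀ + d * κ → ∃ λ P → p (t₀ + d * κ) ≡ (a + b) * v₀ + u * P)
  (p-t-mod-b : ∀ κ J → K₀ ≤ t₀ + d * κ → a * (v₀ + u * J) ≤ p (t₀ + d * κ) →
    ∃ λ y → a * (v₀ + u * J) + b * y ≡ p (t₀ + d * κ))
  (slow : ∀ C F → Eventually λ z → ∀ k → z ≤ k → k ≤ F * z → C * p (k + d) ≤ C * p k + p z)
  (fast : ∀ C → ∃ λ E → Eventually λ z → ∀ k → E * z ≤ k → C * p z ≤ p k)
  (increasing : Eventually λ k → p k + k ≤ p (k + d))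
  where

  private
    instance
      a≢0 : NonZero a
      a≢0 = >-nonZero 0<a
      b≢0 : NonZero b
      b≢0 = >-nonZero 0<b
      u≢0 : NonZero u
      u≢0 = >-nonZero 0<u

    lift-solution : ∀ X Y Q → a * X + b * Y ≡ Q →
      a * (v₀ + u * X) + b * (v₀ + u * Y) ≡ (a + b) * v₀ + u * Q
    lift-solution X Y _ refl = rearrange a b u v₀ X Y
      where
      rearrange : ∀ a b u v X Y → a * (v + u * X) + b * (v + u * Y) ≡ (a + b) * v + u * (a * X + b * Y)
      rearrange = solve-∀

    v-positive : ∀ X → 0 < X → 0 < v₀ + u * X
    v-positive X 0<X = <-≤-trans 0<X (≤-trans (m≤n*m X u) (m≤n+m (u * X) v₀))

    cancel-u : ∀ {x y e} → e + u * x ≤ e + u * y → x ≤ y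
    cancel-u {e = e} le = *-cancelˡ-≤ u (+-cancelˡ-≤ e _ _ le)

  -- The two growth hypotheses become `W-large` and `P-large` when `(a + b) * v₀` is removed and `u`
  -- is cancelled.
  switch-solution : ∀ {α β} → α ≢ β → ∀ κ ζ → let k = t₀ + d * κ ; z = v₀ + u * ζ in
    K₀ ≤ k → K₀ ≤ z → (2 + b) * p (k + d) + (a + b) * v₀ ≤ (2 + b) * p k + p z →
    2 * (a + b) * p z ≤ p k →
    c k ≡ α → c (k + d) ≡ β → c z ≡ β → S
  switch-solution {α} {β} α≢β κ ζ K₀≤k K₀≤z pz-large pk-large kα k′β zβ =
    go (p-step κ K₀≤k) (p-v-mod-u ζ K₀≤z) (p-t-mod-u κ K₀≤k)
    where
    k = t₀ + d * κ
    z = v₀ + u * ζ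
    go : (∃ λ m → p (k + d) ≡ p k + a * (u * m) × ¬ (2 ℕ.∣ m) × Coprime m a × Coprime m b) →
      (∃ λ W → p z ≡ (a + b) * v₀ + u * W) → (∃ λ P → p k ≡ (a + b) * v₀ + u * P) → S
    go (m , k′≡ , 2∤m , com-a , com-b) (W , z≡) (P , k≡) =
      odd-modulus-forces-solution α≢β (λ X → c (v₀ + u * X)) {n = m} {W = W} {P = P}
        0<a 0<b coab com-a com-b 2∤m W-large P-large step
        (λ X Y 0<X 0<Y eq Xα Yα → mono α _ _ k K₀≤k (v-positive X 0<X) (v-positive Y 0<Y)
          (trans (lift-solution X Y P eq) (sym k≡)) Xα Yα kα)
        (λ X Y 0<X 0<Y eq Xβ Yβ → mono β _ _ z K₀≤z (v-positive X 0<X) (v-positive Y 0<Y)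
          (trans (lift-solution X Y W eq) (sym z≡)) Xβ Yβ zβ)
      where
      W-large : a * ((2 + b) * m) ≤ W
      W-large = cancel-u {e = (a + b) * v₀} (≤-from 0
        (subst₂ (λ s t → (2 + b) * s + (a + b) * v₀ ≤ (2 + b) * p k + t) k′≡ z≡ pz-large)
        (rearrange ((a + b) * v₀) a b u m W (p k)))
        where
        rearrange : ∀ e a b u m W q → e + u * (a * ((2 + b) * m)) + ((2 + b) * q + (e + u * W)) + 0
          ≡ e + u * W + ((2 + b) * (q + a * (u * m)) + e)
        rearrange = solve-∀
      P-large : 2 * (a + b) * W ≤ P
      P-large = cancel-u {e = (a + b) * v₀} (≤-trans (begin
        e + u * (f * W)        ≡⟨ cong (λ w → e + w) (*-assoc-comm u f W) ⟩
        e + f * (u * W)        ≤⟨ +-monoˡ-≤ (f * (u * W)) (m≤n*m e f) ⟩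
        f * e + f * (u * W)    ≡⟨ *-distribˡ-+ f e (u * W) ⟨
        f * (e + u * W)        ≡⟨ cong (f *_) z≡ ⟨
        f * p z                ≤⟨ pk-large ⟩
        p k                    ∎) (≤-reflexive k≡))
        where
        open ≤-Reasoning
        e = (a + b) * v₀
        f = 2 * (a + b)
        instance
          f≢0 : NonZero f
          f≢0 = >-nonZero (<-≤-trans 0<a (≤-trans (m≤m+n a b) (m≤m+n (a + b) _)))
        *-assoc-comm : ∀ u f W → u * (f * W) ≡ f * (u * W)
        *-assoc-comm = solve-∀
      step : ∀ X → 0 < X → a * X < P → c (v₀ + u * X) ≡ α → c (v₀ + u * (X + m)) ≡ β → S
      step X 0<X aX<P Xα X′β = by-y (p-t-mod-b κ X K₀≤k (<⇒≤ ax<pk))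
        where
        x = v₀ + u * X
        ax<pk : a * x < p k
        ax<pk = begin-strict
          a * (v₀ + u * X)           ≡⟨ rearrange a u v₀ X ⟩
          a * v₀ + u * (a * X)       <⟨ +-mono-≤-< (*-monoˡ-≤ v₀ (m≤m+n a b)) (*-monoʳ-< u aX<P) ⟩
          (a + b) * v₀ + u * P       ≡⟨ k≡ ⟨
          p k                        ∎
          where
          open ≤-Reasoning
          rearrange : ∀ a u v X → a * (v + u * X) ≡ a * v + u * (a * X)
          rearrange = solve-∀
        by-y : (∃ λ y → a * x + b * y ≡ p k) → S
        by-y (y , eq) = by-colour (two-colours α≢β (c y))
          where
          0<y : 0 < y
          0<y = n≢0⇒n>0 λ { refl → <-irrefl (trans (sym (trans (cong (λ w → a * x + w) (*-zeroʳ b)) (+-identityʳ _))) eq) ax<pk }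
          by-colour : (c y ≡ α) ⊎ (c y ≡ β) → S
          by-colour (inj₁ yα) = mono α x y k K₀≤k (v-positive X 0<X) 0<y eq Xα yα kα
          -- Raising `x` by `u * m` with `y` fixed turns the solution for `k` into one for `k + d`,
          -- now all of colour `β`.
          by-colour (inj₂ yβ) = mono β (v₀ + u * (X + m)) y (k + d) (≤-trans K₀≤k (m≤m+n k d))
            (v-positive (X + m) (≤-trans 0<X (m≤m+n X m))) 0<y shifted X′β yβ k′β
            where
            rearrange : ∀ a v u X m t → a * (v + u * (X + m)) + t ≡ a * (v + u * X) + t + a * (u * m)
            rearrange = solve-∀
            shifted : a * (v₀ + u * (X + m)) + b * y ≡ p (k + d)
            shifted = trans (rearrange a v₀ u X m (b * y)) (trans (cong (_+ a * (u * m)) eq) (sym k′≡))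

  private
    -- `suc` makes `E` positive, so that `E * z ≤ k` also yields `z ≤ k`.
    E : ℕ
    E = suc (proj₁ (fast (2 * (a + b))))

  nearby-solution : ∀ F → Eventually λ z → ∀ {α β} → α ≢ β → ∀ κ ζ → z ≡ v₀ + u * ζ →
    let k = t₀ + d * κ in E * z ≤ k → k ≤ F * z → c k ≡ α → c (k + d) ≡ β → c z ≡ β → S
  nearby-solution F = eventually-map
    (λ { z (slow-z , fast-z , inc , K₀≤z , v≤z) α≢β κ ζ refl Ez≤k k≤Fz →
      let k = t₀ + d * κ
          z≤k = ≤-trans (m≤m+n z _) Ez≤k
      in switch-solution α≢β κ ζ (≤-trans K₀≤z z≤k) K₀≤z
        (≤-from 0 (+-mono-≤ (slow-z k z≤k k≤Fz) (+-mono-≤ (inc k z≤k) (≤-trans v≤z z≤k)))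
          (rearrange b (p (k + d)) (p k) (p z) ((a + b) * v₀) k))
        (fast-z k (≤-trans (m≤n+m _ z) Ez≤k)) })
    -- One copy of the increment more than the `2 + b` required: the increment is at least `k`, so
    -- the extra copy absorbs `(a + b) * v₀`.
    (slow (3 + b) F ∧ proj₂ (fast (2 * (a + b))) ∧ onwards increasing ∧ at-least K₀ ∧ at-least ((a + b) * v₀))
    where
    rearrange : ∀ b q′ q w e k → (2 + b) * q′ + e + ((3 + b) * q + w + (q′ + k)) + 0
      ≡ (2 + b) * q + w + ((3 + b) * q′ + (q + k + e))
    rearrange = solve-∀

  module _ (0<d : 0 < d) where
    private
      instance
        d≢0 : NonZero d
        d≢0 = >-nonZero 0<d

      D : ℕ
      D = 2 * u * E

      0<D : 0 < D
      0<D = *-mono-< (*-mono-< (s≤s (z≤n {1})) 0<u) (s≤s (z≤n {proj₁ (fast (2 * (a + b)))}))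

      instance
        D≢0 : NonZero D
        D≢0 = >-nonZero 0<D

      κ≤k : ∀ κ → κ ≤ t₀ + d * κ
      κ≤k κ = ≤-trans (m≤n*m κ d) (m≤n+m (d * κ) t₀)

      -- For `ζ = k / D`, the bound `v₀ < u ≤ u * ζ` costs a factor 2 in `E * z ≤ k`, and rounding
      -- in the division costs another one, whence `4 * E`.
      midpoint : ∀ k → D ≤ k → ∃ λ ζ → E * (v₀ + u * ζ) ≤ k × k ≤ 4 * E * (v₀ + u * ζ)
      midpoint k D≤k = ζ , (begin
          E * (v₀ + u * ζ)          ≤⟨ *-monoʳ-≤ E (+-monoˡ-≤ (u * ζ) (≤-trans (<⇒≤ v₀<u) (m≤m*n u ζ {{>-nonZero 0<ζ}}))) ⟩
          E * (u * ζ + u * ζ)       ≡⟨ rearrange E u ζ ⟩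
          ζ * D                     ≤⟨ m/n*n≤m k D ⟩
          k                         ∎) , (begin
          k                         ≡⟨ m≡m%n+[m/n]*n k D ⟩
          k % D + ζ * D             ≤⟨ +-monoˡ-≤ (ζ * D) (≤-trans (<⇒≤ (m%n<n k D)) (m≤n*m D ζ {{>-nonZero 0<ζ}})) ⟩
          ζ * D + ζ * D             ≡⟨ rearrange′ E u ζ ⟩
          4 * E * (u * ζ)           ≤⟨ *-monoʳ-≤ (4 * E) (m≤n+m (u * ζ) v₀) ⟩
          4 * E * (v₀ + u * ζ)      ∎)
        where
        open ≤-Reasoning
        ζ = k / D
        0<ζ : 0 < ζ
        0<ζ = m≥n⇒m/n>0 D≤k
        rearrange : ∀ E u ζ → E * (u * ζ + u * ζ) ≡ ζ * (2 * u * E)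
        rearrange = solve-∀
        rearrange′ : ∀ E u ζ → ζ * (2 * u * E) + ζ * (2 * u * E) ≡ 4 * E * (u * ζ)
        rearrange′ = solve-∀

    -- One `z` below both switches and within bounded ratio of both serves for the two of them:
    -- whatever its colour, one switch changes to that colour, and `nearby-solution` applies to it.
    opposite-switches : ∀ C → 0 < C → Eventually λ κ → ∀ {α β} → α ≢ β → ∀ κ′ → κ ≤ κ′ → κ′ ≤ C * κ →
      c (t₀ + d * κ) ≡ α → c (t₀ + d * suc κ) ≡ β → c (t₀ + d * κ′) ≡ β → c (t₀ + d * suc κ′) ≡ α → S
    opposite-switches C 0<C = combine (nearby-solution F)
      where
      F : ℕ
      F = C * (4 * E)
      instance
        C≢0 : NonZero C
        C≢0 = >-nonZero 0<C
        F≢0 : NonZero F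
        F≢0 = m*n≢0 C (4 * E)
      next : ∀ κ → t₀ + d * κ + d ≡ t₀ + d * suc κ
      next κ = rearrange t₀ d κ
        where
        rearrange : ∀ t d κ → t + d * κ + d ≡ t + d * suc κ
        rearrange = solve-∀
      combine : Eventually (λ z → ∀ {α β} → α ≢ β → ∀ κ ζ → z ≡ v₀ + u * ζ →
          let k = t₀ + d * κ in E * z ≤ k → k ≤ F * z → c k ≡ α → c (k + d) ≡ β → c z ≡ β → S) →
        Eventually (λ κ → ∀ {α β} → α ≢ β → ∀ κ′ → κ ≤ κ′ → κ′ ≤ C * κ →
          c (t₀ + d * κ) ≡ α → c (t₀ + d * suc κ) ≡ β → c (t₀ + d * κ′) ≡ β → c (t₀ + d * suc κ′) ≡ α → S)
      combine (Z , nearby) = D + F * Z , λ κ large → at κ large (midpoint _ (≤-trans (≤-trans (m≤m+n D _) large) (κ≤k κ)))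
        where
        at : ∀ κ → D + F * Z ≤ κ → (∃ λ ζ → E * (v₀ + u * ζ) ≤ t₀ + d * κ × t₀ + d * κ ≤ 4 * E * (v₀ + u * ζ)) →
          ∀ {α β} → α ≢ β → ∀ κ′ → κ ≤ κ′ → κ′ ≤ C * κ →
          c (t₀ + d * κ) ≡ α → c (t₀ + d * suc κ) ≡ β → c (t₀ + d * κ′) ≡ β → c (t₀ + d * suc κ′) ≡ α → S
        at κ large (ζ , Ez≤k , k≤4Ez) {α} {β} α≢β κ′ κ≤κ′ κ′≤Cκ kα k⁺β k′β k′⁺α = by-colour (two-colours α≢β (c z))
          where
          z = v₀ + u * ζ
          k≤Fz : t₀ + d * κ ≤ F * z
          k≤Fz = ≤-trans k≤4Ez (*-monoˡ-≤ z (m≤n*m (4 * E) C))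
          Z≤z : Z ≤ z
          Z≤z = *-cancelˡ-≤ F (≤-trans (≤-trans (m≤n+m (F * Z) D) large) (≤-trans (κ≤k κ) k≤Fz))
          k≤k′ : t₀ + d * κ ≤ t₀ + d * κ′
          k≤k′ = +-monoʳ-≤ t₀ (*-monoʳ-≤ d κ≤κ′)
          k′≤Fz : t₀ + d * κ′ ≤ F * z
          k′≤Fz = begin
            t₀ + d * κ′               ≤⟨ +-mono-≤ (m≤n*m t₀ C) (*-monoʳ-≤ d κ′≤Cκ) ⟩
            C * t₀ + d * (C * κ)      ≡⟨ rearrange C t₀ d κ ⟩
            C * (t₀ + d * κ)          ≤⟨ *-monoʳ-≤ C k≤4Ez ⟩
            C * (4 * E * z)           ≡⟨ *-assoc C (4 * E) z ⟨
            F * z                     ∎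
            where
            open ≤-Reasoning
            rearrange : ∀ C t d κ → C * t + d * (C * κ) ≡ C * (t + d * κ)
            rearrange = solve-∀
          by-colour : (c z ≡ α) ⊎ (c z ≡ β) → S
          by-colour (inj₂ zβ) = nearby z Z≤z α≢β κ ζ refl Ez≤k k≤Fz kα (trans (cong c (next κ)) k⁺β) zβ
          by-colour (inj₁ zα) = nearby z Z≤z (λ eq → α≢β (sym eq)) κ′ ζ refl (≤-trans Ez≤k k≤k′) k′≤Fz
            k′β (trans (cong c (next κ′)) k′⁺α) zα

-- Blocks of constant colour on the class of `t`

find-switch : ∀ (γ : ℕ → Fin 2) {α β} → α ≢ β → ∀ x n → γ x ≡ α → γ (x + n) ≡ β →
  ∃ λ y → x ≤ y × y < x + n × γ y ≡ α × γ (suc y) ≡ β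
find-switch γ α≢β x zero xα xβ = contradiction (trans (sym xα) (trans (cong γ (sym (+-identityʳ x))) xβ)) α≢β
find-switch γ α≢β x (suc n) xα x′β with two-colours α≢β (γ (x + n))
... | inj₁ yα = x + n , m≤m+n x n , +-monoʳ-< x ≤-refl , yα , trans (cong γ (sym (+-suc x n))) x′β
... | inj₂ yβ with find-switch γ α≢β x n xα yβ
...   | y , x≤y , y<x+n , yα , y′β = y , x≤y , <-trans y<x+n (+-monoʳ-< x ≤-refl) , yα , y′β

switch-between : ∀ (γ : ℕ → Fin 2) {α β} → α ≢ β → ∀ {x z} → x ≤ z → γ x ≡ α → γ z ≡ β →
  ∃ λ y → x ≤ y × y < z × γ y ≡ α × γ (suc y) ≡ β
switch-between γ α≢β {x} x≤z xα zβ with m≤n⇒∃[o]m+o≡n x≤z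
... | n , refl = find-switch γ α≢β x n xα zβ

nearby-linear-solution : ∀ {a b Q} s → Coprime a b → 0 < b → a * (s + b) ≤ Q →
  ∃₂ λ X Y → s ≤ X × X < s + b × a * X + b * Y ≡ Q
nearby-linear-solution {a} {b} {Q} s coab 0<b le
  with offset-solution {a} {b} {Q} s 1 coab (1-coprimeTo b) 0<b (subst (λ w → a * (s + w) ≤ Q) (sym (*-identityʳ b)) le)
... | i , Y , i<b , eq = s + i , Y , m≤m+n s i , +-monoʳ-< s i<b , subst (λ w → a * (s + w) + b * Y ≡ Q) (*-identityʳ i) eq

module Blocks {S : Set} (γ : ℕ → Fin 2) (Q : ℕ → ℕ) {a b : ℕ} (K₁ : ℕ)
  (0<a : 0 < a) (0<b : 0 < b) (coab : Coprime a b)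
  (mono : ∀ δ X Y κ → K₁ ≤ κ → 0 < X → 0 < Y → a * X + b * Y ≡ Q κ →
    γ X ≡ δ → γ Y ≡ δ → γ κ ≡ δ → S)
  (opposite : ∀ C → 0 < C → Eventually λ κ → ∀ {α β} → α ≢ β → ∀ κ′ → κ ≤ κ′ → κ′ ≤ C * κ →
    γ κ ≡ α → γ (suc κ) ≡ β → γ κ′ ≡ β → γ (suc κ′) ≡ α → S)
  (Q-slow : ∀ C → Eventually λ κ → C * Q (suc κ) ≤ C * Q κ + Q κ)
  (Q-gap : ∀ C → Eventually λ κ → Q κ + C ≤ Q (suc κ))
  (Q-superlinear : ∀ C → Eventually λ κ → C * κ ≤ Q κ)
  where

  private
    -- The second switch lies below `q ≤ (a + b) * suc s`, and the solution near `s` compared with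
    -- it has coordinates of at least half of `suc s`; hence the ratio `2 * (a + b)`.
    C : ℕ
    C = 2 * (a + b)

    0<a+b : 0 < a + b
    0<a+b = ≤-trans 0<a (m≤m+n a b)

    0<C : 0 < C
    0<C = ≤-trans 0<a+b (m≤m+n (a + b) _)

    instance
      a≢0 : NonZero a
      a≢0 = >-nonZero 0<a
      b≢0 : NonZero b
      b≢0 = >-nonZero 0<b
      a+b≢0 : NonZero (a + b)
      a+b≢0 = >-nonZero 0<a+b

    N : ℕ
    N = proj₁ (opposite C 0<C)

    -- An `α` above the switch needs a change back from `β` to `α`, which is an opposite switch
    -- within ratio `C`. `below-switch` is the same argument downwards.
    above-switch : ∀ {α β} → α ≢ β → ∀ {κ} → N ≤ κ → γ κ ≡ α → γ (suc κ) ≡ β →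
      ∀ {j} → κ < j → j ≤ C * κ → γ j ≡ α → S
    above-switch α≢β {κ} N≤κ κα κ′β κ<j j≤Cκ jα with switch-between γ (α≢β ∘ sym) κ<j κ′β jα
    ... | y , κ<y , y<j , yβ , y′α = proj₂ (opposite C 0<C) κ N≤κ α≢β y (<⇒≤ κ<y) (≤-trans (<⇒≤ y<j) j≤Cκ) κα κ′β yβ y′α

    below-switch : ∀ {α β} → α ≢ β → ∀ {κ} → γ κ ≡ α → γ (suc κ) ≡ β →
      ∀ {j} → N ≤ j → j ≤ κ → κ ≤ C * j → γ j ≡ β → S
    below-switch α≢β {κ} κα κ′β N≤j j≤κ κ≤Cj jβ with switch-between γ (α≢β ∘ sym) j≤κ jβ κα
    ... | y , j≤y , y<κ , yβ , y′α = proj₂ (opposite C 0<C) y (≤-trans N≤j j≤y) (α≢β ∘ sym) κ (<⇒≤ y<κ)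
            (≤-trans κ≤Cj (*-monoʳ-≤ C j≤y)) yβ y′α κα κ′β

    2≤a+b : 2 ≤ a + b
    2≤a+b = +-mono-≤ 0<a 0<b

    double≤C* : ∀ x → x + x ≤ C * x
    double≤C* x = ≤-trans (≤-reflexive (cong (λ w → x + w) (sym (+-identityʳ x)))) (*-monoˡ-≤ x (≤-trans 2≤a+b (m≤m+n (a + b) _)))

    -- The switch is written `b + κ₀` so that the window of `b` candidates just below it starts at
    -- the natural number `κ₀`.
    module AtSwitch {α β : Fin 2} (α≢β : α ≢ β) (κ₀ : ℕ)
      (K₁≤κ : K₁ ≤ b + κ₀) (N≤κ₀ : N + (2 * a + 1 + b) ≤ κ₀)
      (slow : 2 * b * Q (suc (b + κ₀)) ≤ 2 * b * Q (b + κ₀) + Q (b + κ₀))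
      (gap : Q (b + κ₀) + (2 * a * b + b) ≤ Q (suc (b + κ₀)))
      (big : (2 * (a + b) * a + 2 * b * ((a + b) * (a + b))) * (b + κ₀) ≤ Q (b + κ₀))
      (big′ : 2 * (a + b) * (b + κ₀) ≤ Q (b + κ₀))
      (κα : γ (b + κ₀) ≡ α) (κ′β : γ (suc (b + κ₀)) ≡ β) where

      κ : ℕ
      κ = b + κ₀

      -- `s` is the diagonal point: `a * X + b * Y ≡ q` has a solution with both coordinates close
      -- to `s`.
      q s : ℕ
      q = Q (suc κ)
      s = q / (a + b)

      1≤κ : 1 ≤ κ
      1≤κ = ≤-trans 0<b (m≤m+n b κ₀)

      big-q : 2 * (a + b) * κ ≤ q
      big-q = ≤-trans big′ (≤-trans (m≤m+n _ _) gap)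

      [a+b]s≤q : (a + b) * s ≤ q
      [a+b]s≤q = ≤-trans (≤-reflexive (*-comm (a + b) s)) (m/n*n≤m q (a + b))

      q≤[a+b][1+s] : q ≤ (a + b) * suc s
      q≤[a+b][1+s] = begin
        q                                  ≡⟨ m≡m%n+[m/n]*n q (a + b) ⟩
        q % (a + b) + s * (a + b)          ≤⟨ +-monoˡ-≤ (s * (a + b)) (<⇒≤ (m%n<n q (a + b))) ⟩
        suc s * (a + b)                    ≡⟨ *-comm (suc s) (a + b) ⟩
        (a + b) * suc s                    ∎
        where open ≤-Reasoning

      κ≤s : κ ≤ s
      κ≤s = subst (_≤ s) (m*n/n≡m κ (a + b)) (/-mono-≤ (≤-trans (≤-reflexive (*-comm κ (a + b)))
        (≤-trans (*-monoˡ-≤ κ (m≤m+n (a + b) _)) big-q)) (≤-refl {a + b}))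

      N+2a+1≤s : N + (2 * a + 1) ≤ s
      N+2a+1≤s = ≤-trans (+-monoʳ-≤ N (m≤m+n (2 * a + 1) b)) (≤-trans N≤κ₀ (≤-trans (m≤n+m κ₀ b) κ≤s))

      2a+1≤s : 2 * a + 1 ≤ s
      2a+1≤s = ≤-trans (m≤n+m _ N) N+2a+1≤s

      b<κ₀ : suc b ≤ κ₀
      b<κ₀ = ≤-trans (s≤s (m≤n+m b (2 * a))) (≤-trans (≤-reflexive (cong (_+ b) (+-comm 1 (2 * a)))) (≤-trans (m≤n+m _ N) N≤κ₀))

      finish : ∀ {X Y X′ Y′} → κ₀ ≤ X → X < κ₀ + b → a * X + b * Y ≡ Q κ →
        suc κ ≤ X′ → X′ < suc κ + b → a * X′ + b * Y′ ≡ q → S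
      finish {X} {Y} {X′} {Y′} κ₀≤X X<κ eq κ<X′ X′<κ+b eq′ =
        by-cases (two-colours α≢β (γ X)) (two-colours α≢β (γ Y)) (two-colours α≢β (γ X′)) (two-colours α≢β (γ Y′))
        where
        X≤κ : X ≤ κ
        X≤κ = ≤-trans (<⇒≤ X<κ) (≤-reflexive (+-comm κ₀ b))

        -- `Y` is about `Q κ / b` and `s` about `Q κ / (a + b)`. Multiplied by `2 * (a + b) * b`,
        -- they differ by about `2 * a * Q κ`; `slow` costs one `Q κ`, and what is left covers the
        -- lower-order terms by `big`.
        s+a+b≤Y : s + (a + b) ≤ Y
        s+a+b≤Y = *-cancelˡ-≤ {n = Y} (2 * (a + b) * b) {{m*n≢0 (2 * (a + b)) b {{m*n≢0 2 (a + b)}}}} (≤-from 0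
          (+-mono-≤ (*-monoʳ-≤ (2 * b) [a+b]s≤q) (+-mono-≤ slow (+-mono-≤ big (+-mono-≤ (*-monoʳ-≤ (2 * (a + b) * a) X≤κ)
            (+-mono-≤ (*-monoʳ-≤ (2 * b * ((a + b) * (a + b))) 1≤κ) (+-mono-≤ (*-monoʳ-≤ (2 * (a + b)) (≤-reflexive (sym eq)))
              (*-monoʳ-≤ 2 (m≤n*m (Q κ) a))))))))
          (rearrange a b s q (Q κ) κ X Y))
          where
          rearrange : ∀ a b s q Q κ X Y → 2 * (a + b) * b * (s + (a + b)) +
            (2 * b * q + (2 * b * Q + Q + (Q + (2 * (a + b) * a * κ + (2 * b * ((a + b) * (a + b)) * κ + (2 * (a + b) * (a * X + b * Y) + 2 * (a * Q))))))) + 0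
            ≡ 2 * (a + b) * b * Y + (2 * b * ((a + b) * s) + (2 * b * q + ((2 * (a + b) * a + 2 * b * ((a + b) * (a + b))) * κ
              + (2 * (a + b) * a * X + (2 * b * ((a + b) * (a + b)) * 1 + (2 * (a + b) * Q + 2 * Q))))))
          rearrange = solve-∀

        -- `X′` exceeds `X` by at most `2 * b`, which uses up `2 * a * b` of `gap`; the remaining
        -- `b` gives strictness.
        Y<Y′ : Y < Y′
        Y<Y′ = *-cancelˡ-≤ b (≤-from 0
          (+-mono-≤ gap (+-mono-≤ (*-monoʳ-≤ a κ₀≤X) (+-mono-≤ (*-monoʳ-≤ a (s≤s⁻¹ X′<κ+b))
            (+-mono-≤ (≤-reflexive eq) (≤-reflexive (sym eq′))))))
          (rearrange a b κ₀ (Q κ) q X X′ Y Y′))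
          where
          rearrange : ∀ a b κ₀ Q q X X′ Y Y′ → b * suc Y + (q + (a * X + (a * (b + κ₀ + b) + (Q + (a * X′ + b * Y′))))) + 0
            ≡ b * Y′ + (Q + (2 * a * b + b) + (a * κ₀ + (a * X′ + (a * X + b * Y + q))))
          rearrange = solve-∀

        0<Y : 0 < Y
        0<Y = ≤-trans 0<a+b (≤-trans (m≤n+m (a + b) s) s+a+b≤Y)

        N≤κ₀′ : N ≤ κ₀
        N≤κ₀′ = ≤-trans (m≤m+n N _) N≤κ₀

        0<X : 0 < X
        0<X = ≤-trans (≤-trans (s≤s z≤n) b<κ₀) κ₀≤X

        Y′≤q : Y′ ≤ q
        Y′≤q = ≤-trans (m≤n*m Y′ b) (≤-trans (m≤n+m _ (a * X′)) (≤-reflexive eq′))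

        -- `X″` and `Y″` lie below the switch from `β` to `α` and within ratio `C` of it, so an `α`
        -- on either is excluded by `below-switch`. If both are `β`, they form a solution with
        -- `suc κ`.
        in-β-block : ∀ {X″ Y″} → s ≤ X″ → X″ < s + b → a * X″ + b * Y″ ≡ q →
          ∀ {κ′} → Y ≤ κ′ → κ′ < Y′ → γ κ′ ≡ β → γ (suc κ′) ≡ α → S
        in-β-block {X″} {Y″} s≤X″ X″<s+b eq″ {κ′} Y≤κ′ κ′<Y′ switchβ switchα =
          by-colours (two-colours α≢β (γ X″)) (two-colours α≢β (γ Y″))
          where
          Y″≤s+a+b : Y″ ≤ s + (a + b)
          Y″≤s+a+b = *-cancelˡ-≤ b (≤-from 0
            (+-mono-≤ q≤[a+b][1+s] (+-mono-≤ (*-monoʳ-≤ a s≤X″) (+-mono-≤ (≤-reflexive eq″) (m≤n*m (a + b) b))))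
            (rearrange a b q s X″ Y″))
            where
            rearrange : ∀ a b q s X Y → b * Y + ((a + b) * suc s + (a * X + (q + b * (a + b)))) + 0
              ≡ b * (s + (a + b)) + (q + (a * s + (a * X + b * Y + (a + b))))
            rearrange = solve-∀
          s≤Y″+a : s ≤ Y″ + a
          s≤Y″+a = *-cancelˡ-≤ b (≤-from 0
            (+-mono-≤ [a+b]s≤q (+-mono-≤ (*-monoʳ-≤ a (<⇒≤ X″<s+b)) (≤-reflexive (sym eq″))))
            (rearrange a b q s X″ Y″))
            where
            rearrange : ∀ a b q s X Y → b * s + (q + (a * (s + b) + (a * X + b * Y))) + 0
              ≡ b * (Y + a) + ((a + b) * s + (a * X + q))
            rearrange = solve-∀
          X″≤κ′ : X″ ≤ κ′
          X″≤κ′ = ≤-trans (<⇒≤ X″<s+b) (≤-trans (+-monoʳ-≤ s (m≤n+m b a)) (≤-trans s+a+b≤Y Y≤κ′))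
          Y″≤κ′ : Y″ ≤ κ′
          Y″≤κ′ = ≤-trans Y″≤s+a+b (≤-trans s+a+b≤Y Y≤κ′)
          κ′≤C* : ∀ {w} → suc s ≤ 2 * w → κ′ ≤ C * w
          κ′≤C* {w} le = begin
            κ′                 ≤⟨ <⇒≤ κ′<Y′ ⟩
            Y′                 ≤⟨ Y′≤q ⟩
            q                  ≤⟨ q≤[a+b][1+s] ⟩
            (a + b) * suc s    ≤⟨ *-monoʳ-≤ (a + b) le ⟩
            (a + b) * (2 * w)  ≡⟨ rearrange (a + b) w ⟩
            C * w              ∎
            where
            open ≤-Reasoning
            rearrange : ∀ x w → x * (2 * w) ≡ 2 * x * w
            rearrange = solve-∀
          1+s≤2Y″ : suc s ≤ 2 * Y″
          1+s≤2Y″ = ≤-from 0 (+-mono-≤ (*-monoʳ-≤ 2 s≤Y″+a) 2a+1≤s) (rearrange a s Y″)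
            where
            rearrange : ∀ a s Y → suc s + (2 * (Y + a) + s) + 0 ≡ 2 * Y + (2 * s + (2 * a + 1))
            rearrange = solve-∀
          1+s≤2X″ : suc s ≤ 2 * X″
          1+s≤2X″ = ≤-from 0 (+-mono-≤ (*-monoʳ-≤ 2 s≤X″) (≤-trans (m≤n+m 1 (2 * a)) 2a+1≤s)) (rearrange s X″)
            where
            rearrange : ∀ s X → suc s + (2 * X + s) + 0 ≡ 2 * X + (2 * s + 1)
            rearrange = solve-∀
          N<Y″ : N + 1 ≤ Y″
          N<Y″ = ≤-from a (+-mono-≤ N+2a+1≤s s≤Y″+a) (rearrange N a s Y″)
            where
            rearrange : ∀ N a s Y → N + 1 + (s + (Y + a)) + a ≡ Y + (N + (2 * a + 1) + s)
            rearrange = solve-∀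
          N≤X″ : N ≤ X″
          N≤X″ = ≤-trans (m≤m+n N _) (≤-trans N+2a+1≤s s≤X″)
          by-colours : (γ X″ ≡ α) ⊎ (γ X″ ≡ β) → (γ Y″ ≡ α) ⊎ (γ Y″ ≡ β) → S
          by-colours (inj₁ X″α) _ = below-switch (α≢β ∘ sym) switchβ switchα N≤X″ X″≤κ′ (κ′≤C* 1+s≤2X″) X″α
          by-colours _ (inj₁ Y″α) = below-switch (α≢β ∘ sym) switchβ switchα (≤-trans (m≤m+n N 1) N<Y″) Y″≤κ′ (κ′≤C* 1+s≤2Y″) Y″α
          by-colours (inj₂ X″β) (inj₂ Y″β) = mono β X″ Y″ (suc κ) (m≤n⇒m≤1+n K₁≤κ)
            (≤-trans (≤-trans (m≤n+m 1 (2 * a)) 2a+1≤s) s≤X″) (≤-trans (m≤n+m 1 N) N<Y″) eq″ X″β Y″β κ′β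

        by-cases : (γ X ≡ α) ⊎ (γ X ≡ β) → (γ Y ≡ α) ⊎ (γ Y ≡ β) →
          (γ X′ ≡ α) ⊎ (γ X′ ≡ β) → (γ Y′ ≡ α) ⊎ (γ Y′ ≡ β) → S
        by-cases (inj₂ Xβ) _ _ _ = below-switch α≢β κα κ′β (≤-trans N≤κ₀′ κ₀≤X) X≤κ
          (≤-trans (≤-trans (+-monoˡ-≤ κ₀ (<⇒≤ b<κ₀)) (+-mono-≤ κ₀≤X κ₀≤X)) (double≤C* X)) Xβ
        by-cases (inj₁ Xα) (inj₁ Yα) _ _ = mono α X Y κ K₁≤κ 0<X 0<Y eq Xα Yα κα
        by-cases _ _ (inj₁ X′α) _ = above-switch α≢β (≤-trans N≤κ₀′ (m≤n+m κ₀ b)) κα κ′β κ<X′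
          (≤-trans (≤-trans (s≤s⁻¹ X′<κ+b) (+-monoʳ-≤ κ (m≤m+n b κ₀))) (double≤C* κ)) X′α
        by-cases _ _ (inj₂ X′β) (inj₂ Y′β) = mono β X′ Y′ (suc κ) (m≤n⇒m≤1+n K₁≤κ)
          (≤-trans (s≤s z≤n) κ<X′) (≤-trans (s≤s z≤n) Y<Y′) eq′ X′β Y′β κ′β
        -- The one case left: the colours of `Y` and `Y′` enclose a switch from `β` to `α`.
        by-cases _ (inj₂ Yβ) _ (inj₁ Y′α) = step₃ (switch-between γ (α≢β ∘ sym) (<⇒≤ Y<Y′) Yβ Y′α)
          (nearby-linear-solution s coab 0<b a[s+b]≤q)
          where
          a[s+b]≤q : a * (s + b) ≤ q
          a[s+b]≤q = ≤-from (b * a + b) (+-mono-≤ [a+b]s≤q (*-monoʳ-≤ b 2a+1≤s)) (rearrange a b s q)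
            where
            rearrange : ∀ a b s q → a * (s + b) + (q + b * s) + (b * a + b) ≡ q + ((a + b) * s + b * (2 * a + 1))
            rearrange = solve-∀
          step₃ : (∃ λ y → Y ≤ y × y < Y′ × γ y ≡ β × γ (suc y) ≡ α) →
            (∃₂ λ X Y → s ≤ X × X < s + b × a * X + b * Y ≡ q) → S
          step₃ (y , Y≤y , y<Y′ , yβ , y′α) (X″ , Y″ , s≤X″ , X″<s+b , eq″) =
            in-β-block s≤X″ X″<s+b eq″ Y≤y y<Y′ yβ y′α

      solution : S
      solution = go (nearby-linear-solution κ₀ coab 0<b aκ≤Q) (nearby-linear-solution (suc κ) coab 0<b aκ′≤q)
        where
        a≤2[a+b] : a ≤ 2 * (a + b)
        a≤2[a+b] = ≤-trans (m≤m+n a b) (m≤m+n (a + b) _)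
        aκ≤Q : a * (κ₀ + b) ≤ Q κ
        aκ≤Q = ≤-trans (≤-reflexive (cong (a *_) (+-comm κ₀ b))) (≤-trans (*-monoˡ-≤ κ a≤2[a+b]) big′)
        aκ′≤q : a * (suc κ + b) ≤ q
        aκ′≤q = ≤-trans (*-monoˡ-≤ (suc κ + b) (m≤m+n a b)) (≤-trans (*-monoʳ-≤ (a + b) (begin
            suc κ + b   ≡⟨ +-suc κ b ⟨
            κ + suc b   ≤⟨ +-monoʳ-≤ κ (≤-trans b<κ₀ (m≤n+m κ₀ b)) ⟩
            κ + κ       ∎))
            (≤-trans (≤-reflexive (rearrange (a + b) κ)) big-q))
          where
          open ≤-Reasoning
          rearrange : ∀ x κ → x * (κ + κ) ≡ 2 * x * κ
          rearrange = solve-∀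
        go : (∃₂ λ X Y → κ₀ ≤ X × X < κ₀ + b × a * X + b * Y ≡ Q κ) →
          (∃₂ λ X Y → suc κ ≤ X × X < suc κ + b × a * X + b * Y ≡ q) → S
        go (X , Y , l , m , e) (X′ , Y′ , l′ , m′ , e′) = finish l m e l′ m′ e′

    switch-solution : Eventually λ κ → ∀ {α β} → α ≢ β → γ κ ≡ α → γ (suc κ) ≡ β → S
    switch-solution = eventually-map
        (λ κ (slow , gap , big , big′ , large , K₁≤κ) {α} {β} α≢β κα κ′β →
          at-shifted α≢β (trans (+-comm b (κ ∸ b)) (m∸n+n≡m (≤-trans (m≤m+n b _) large)))
            K₁≤κ slow gap big big′ large κα κ′β)
        (Q-slow (2 * b) ∧ Q-gap (2 * a * b + b)
        ∧ Q-superlinear (2 * (a + b) * a + 2 * b * ((a + b) * (a + b))) ∧ Q-superlinear (2 * (a + b))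
        ∧ at-least (b + (N + (2 * a + 1 + b))) ∧ at-least K₁)
      where
      at-shifted : ∀ {α β} → α ≢ β → ∀ {κ₀ κ} → b + κ₀ ≡ κ → K₁ ≤ κ →
        2 * b * Q (suc κ) ≤ 2 * b * Q κ + Q κ → Q κ + (2 * a * b + b) ≤ Q (suc κ) →
        (2 * (a + b) * a + 2 * b * ((a + b) * (a + b))) * κ ≤ Q κ → 2 * (a + b) * κ ≤ Q κ →
        b + (N + (2 * a + 1 + b)) ≤ κ → γ κ ≡ α → γ (suc κ) ≡ β → S
      at-shifted α≢β {κ₀} refl K₁≤κ slow gap big big′ large κα κ′β =
        AtSwitch.solution α≢β κ₀ K₁≤κ (+-cancelˡ-≤ b _ _ large) slow gap big big′ κα κ′β

  -- Beyond a threshold every switch yields a solution. So does a colour different from that of `κ`,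
  -- and otherwise a solution for `κ` with `X` and `Y` above `κ` is monochromatic.
  block-solution : S
  block-solution = combine (onwards switch-solution ∧ Q-superlinear (2 * (a + b)) ∧ at-least (suc b) ∧ at-least K₁)
    where
    combine : Eventually (λ κ → (∀ k → κ ≤ k → ∀ {α β} → α ≢ β → γ k ≡ α → γ (suc k) ≡ β → S) ×
      2 * (a + b) * κ ≤ Q κ × suc b ≤ κ × K₁ ≤ κ) → S
    combine (κ , facts) with facts κ ≤-refl
    ... | at-switch , big , b<κ , K₁≤κ = start (nearby-linear-solution κ coab 0<b fits)
      where
      fits′ : a * (κ + b) + b * κ ≤ Q κ
      fits′ = ≤-from (b * κ) (+-mono-≤ big (*-monoʳ-≤ a (<⇒≤ b<κ))) (rearrange a b κ (Q κ))
        where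
        rearrange : ∀ a b κ Q → a * (κ + b) + b * κ + (Q + a * κ) + b * κ ≡ Q + (2 * (a + b) * κ + a * b)
        rearrange = solve-∀
      fits : a * (κ + b) ≤ Q κ
      fits = ≤-trans (m≤m+n _ (b * κ)) fits′
      0<κ : 0 < κ
      0<κ = ≤-trans (s≤s z≤n) b<κ
      κ≤Y : ∀ {X Y} → X < κ + b → a * X + b * Y ≡ Q κ → κ ≤ Y
      κ≤Y {X} {Y} X<κ+b eq = *-cancelˡ-≤ b (≤-from 0
        (+-mono-≤ fits′ (+-mono-≤ (*-monoʳ-≤ a (<⇒≤ X<κ+b)) (≤-reflexive (sym eq)))) (rearrange a b κ (Q κ) X Y))
        where
        rearrange : ∀ a b κ Q X Y → b * κ + (Q + (a * (κ + b) + (a * X + b * Y))) + 0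
          ≡ b * Y + (a * (κ + b) + b * κ + (a * X + Q))
        rearrange = solve-∀
      unequal : ∀ {α β} → α ≢ β → ∀ {x} → κ ≤ x → γ κ ≡ α → γ x ≡ β → S
      unequal α≢β κ≤x κα xβ with switch-between γ α≢β κ≤x κα xβ
      ... | y , κ≤y , _ , yα , y′β = at-switch y κ≤y α≢β yα y′β
      start : (∃₂ λ X Y → κ ≤ X × X < κ + b × a * X + b * Y ≡ Q κ) → S
      start (X , Y , κ≤X , X<κ+b , eq) with γ X Fin.≟ γ κ | γ Y Fin.≟ γ κ
      ... | no X≢  | _      = unequal (X≢ ∘ sym) κ≤X refl refl
      ... | yes _  | no Y≢  = unequal (Y≢ ∘ sym) (κ≤Y X<κ+b eq) refl refl
      ... | yes X≡ | yes Y≡ = mono (γ κ) X Y κ K₁≤κ (<-≤-trans 0<κ κ≤X) (<-≤-trans 0<κ (κ≤Y X<κ+b eq)) eq X≡ Y≡ refl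

-- The congruence conditions

eval-cong-mod : ∀ p {m x y} → m Signed.∣ x ℤ.- y → m Signed.∣ eval p x ℤ.- eval p y
eval-cong-mod []       {m} _ = Signed.divides 0ℤ refl
eval-cong-mod (c ∷ cs) {m} {x} {y} m∣x-y = subst (m Signed.∣_) (rearrange c x y (eval cs x) (eval cs y))
  (Signed.∣m∣n⇒∣m+n (Signed.∣n⇒∣m*n x (eval-cong-mod cs m∣x-y)) (Signed.∣m⇒∣m*n (eval cs y) m∣x-y))
  where
  rearrange : ∀ c x y s t → x ℤ.* (s ℤ.- t) ℤ.+ (x ℤ.- y) ℤ.* t ≡ c ℤ.+ x ℤ.* s ℤ.- (c ℤ.+ y ℤ.* t)
  rearrange = ℤ.solve-∀

residue-class : ∀ d .{{_ : NonZero d}} t κ → + d Signed.∣ + (t %ℕ d + d * κ) ℤ.- t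
residue-class d t κ = Signed.divides (+ κ ℤ.- t /ℕ d) (begin
  + (t %ℕ d) ℤ.+ + (d * κ) ℤ.- t                                       ≡⟨ cong₂ (λ s r → + (t %ℕ d) ℤ.+ s ℤ.- r) (ℤ.pos-* d κ) (a≡a%ℕn+[a/ℕn]*n t d) ⟩
  + (t %ℕ d) ℤ.+ + d ℤ.* + κ ℤ.- (+ (t %ℕ d) ℤ.+ t /ℕ d ℤ.* + d)       ≡⟨ rearrange (+ (t %ℕ d)) (+ d) (+ κ) (t /ℕ d) ⟩
  (+ κ ℤ.- t /ℕ d) ℤ.* + d                                             ∎)
  where
  open ≡-Reasoning
  rearrange : ∀ r d κ q → r ℤ.+ d ℤ.* κ ℤ.- (r ℤ.+ q ℤ.* d) ≡ (κ ℤ.- q) ℤ.* d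
  rearrange = ℤ.solve-∀

residue-mod : ∀ d .{{_ : NonZero d}} t → + d Signed.∣ t ℤ.- + (t %ℕ d)
residue-mod d t = Signed.divides (t /ℕ d) (trans (cong (ℤ._- + (t %ℕ d)) (a≡a%ℕn+[a/ℕn]*n t d)) (rearrange (+ (t %ℕ d)) (t /ℕ d ℤ.* + d)))
  where
  rearrange : ∀ r q → r ℤ.+ q ℤ.- r ≡ q
  rearrange = ℤ.solve-∀

natural-quotient : ∀ {d x y} → + d Signed.∣ + x ℤ.- + y → y ≤ x → ∃ λ q → x ≡ y + d * q
natural-quotient {d} {x} {y} d∣x-y y≤x with ∣⇒∣ᵤ d∣x-y
... | ℕ.divides q eq = q , (begin
  x              ≡⟨ m+[n∸m]≡n y≤x ⟨
  y + (x ∸ y)    ≡⟨ cong (λ i → y + ∣ i ∣) (trans (ℤ.m-n≡m⊖n x y) (ℤ.⊖-≥ y≤x)) ⟨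
  y + ∣ + x ℤ.- + y ∣ ≡⟨ cong (λ i → y + i) (trans eq (*-comm q d)) ⟩
  y + d * q      ∎)
  where open ≡-Reasoning

-- Replaces the quotient provided by a divisibility by truncated division, so that it becomes a
-- function of the dividend.
quotient-spec : ∀ {d x y q} .{{_ : NonZero d}} → x ≡ y + d * q → x ≡ y + d * ((x ∸ y) / d)
quotient-spec {d} {_} {y} {q} refl = cong (λ i → y + d * i) (sym (begin
  (y + d * q ∸ y) / d   ≡⟨ cong (_/ d) (trans (m+n∸m≡n y (d * q)) (*-comm d q)) ⟩
  (q * d) / d           ≡⟨ m*n/n≡m q d ⟩
  q                     ∎))
  where open ≡-Reasoning

-- From the six conditions to the restricted equations

module Assembly (P : List ℤ) (p : ℕ → ℕ)
  {a b d u : ℕ} {t v : ℤ} (0<a : 0 < a) (0<b : 0 < b) (coab : Coprime a b) (0<d : 0 < d) (0<u : 0 < u)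
  (h₁ : (+ a ℤ.+ + b) ℤ.* t ≡ eval P t [mod + d ])
  (h₂ : (k : ℤ) → k ≡ t [mod + d ] → + a ∣ (eval P (k ℤ.+ + d) ℤ.- eval P k))
  (h₃ : (k : ℤ) → k ≡ t [mod + d ] → (m : ℤ) →
    + a ℤ.* m ≡ eval P (k ℤ.+ + d) ℤ.- eval P k →
    (+ u ∣ m) ×
    ((m′ : ℤ) → + u ℤ.* m′ ≡ m →
    (¬ (+ 2 ∣ m′)) × (gcd (+ a) m′ ≡ 1ℤ) × (gcd (+ b) m′ ≡ 1ℤ) × (gcd (+ u) m′ ≡ 1ℤ)))
  (h₄ : eval P v ≡ (+ a ℤ.+ + b) ℤ.* v [mod + u ])
  (h₅ : (k : ℤ) → k ≡ t [mod + d ] → eval P k ≡ (+ a ℤ.+ + b) ℤ.* v [mod + u ])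
  (h₆ : (j k : ℤ) → j ≡ v [mod + u ] → k ≡ t [mod + d ] → + b ∣ (eval P k ℤ.- + a ℤ.* j))
  (c : Colouring 2) (N : ℕ)
  (p-slow : ∀ C F → Eventually λ z → ∀ k → z ≤ k → k ≤ F * z → C * p (k + d) ≤ C * p k + p z)
  (p-fast : ∀ C → ∃ λ E → Eventually λ z → ∀ k → E * z ≤ k → C * p z ≤ p k)
  (p-increasing : Eventually λ k → p k + k ≤ p (k + d))
  {t₀ v₀ : ℕ} (v₀<u : v₀ < u)
  (t-class : ∀ κ → + d Signed.∣ + (t₀ + d * κ) ℤ.- t) (v-class : ∀ ζ → + u Signed.∣ + (v₀ + u * ζ) ℤ.- v)
  (t-residue : + d Signed.∣ t ℤ.- + t₀) (v-residue : + u Signed.∣ v ℤ.- + v₀)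
  -- `suc N ≤ z` makes every solution found exceed `N`; the two bounds on the next line make the
  -- quotients by `d` and `u` natural numbers.
  (K₀ : ℕ) (large : ∀ z → K₀ ≤ z → suc N ≤ z × + p z ≡ eval P (+ z) × p z + z ≤ p (z + d) ×
    (a + b) * t₀ ≤ p z × (a + b) * v₀ ≤ p z)
  where

  instance
    d≢0 : NonZero d
    d≢0 = >-nonZero 0<d
    u≢0 : NonZero u
    u≢0 = >-nonZero 0<u

  N<z : ∀ {z} → K₀ ≤ z → N < z
  N<z {z} le = proj₁ (large z le)

  p≡ : ∀ {z} → K₀ ≤ z → + p z ≡ eval P (+ z)
  p≡ {z} le = proj₁ (proj₂ (large z le))

  p-inc : ∀ {z} → K₀ ≤ z → p z + z ≤ p (z + d)
  p-inc {z} le = proj₁ (proj₂ (proj₂ (large z le)))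

  t-fits : ∀ {z} → K₀ ≤ z → (a + b) * t₀ ≤ p z
  t-fits {z} le = proj₁ (proj₂ (proj₂ (proj₂ (large z le))))

  v-fits : ∀ {z} → K₀ ≤ z → (a + b) * v₀ ≤ p z
  v-fits {z} le = proj₂ (proj₂ (proj₂ (proj₂ (large z le))))

  Solution : Set
  Solution = Σ ℕ λ x → Σ ℕ λ y → Σ ℕ λ z →
    (0 < x) × (0 < y) × (0 < z) × LinPolyEq a b P x y z × (c x ≡ c y) × (c y ≡ c z) × (N < x + y + z)

  mono : ∀ δ x y z → K₀ ≤ z → 0 < x → 0 < y → a * x + b * y ≡ p z →
    c x ≡ δ → c y ≡ δ → c z ≡ δ → Solution
  mono δ x y z K₀≤z 0<x 0<y eq xδ yδ zδ = x , y , z , 0<x , 0<y , ≤-trans (s≤s z≤n) (N<z K₀≤z) ,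
    (begin
      + a ℤ.* + x ℤ.+ + b ℤ.* + y   ≡⟨ cong₂ ℤ._+_ (ℤ.pos-* a x) (ℤ.pos-* b y) ⟨
      + (a * x + b * y)             ≡⟨ cong (+_) eq ⟩
      + p z                         ≡⟨ p≡ K₀≤z ⟩
      eval P (+ z)                  ∎) ,
    trans xδ (sym yδ) , trans yδ (sym zδ) , ≤-trans (N<z K₀≤z) (m≤n+m z (x + y))
    where open ≡-Reasoning

  pos-a+b : ∀ x → + ((a + b) * x) ≡ (+ a ℤ.+ + b) ℤ.* + x
  pos-a+b x = ℤ.pos-* (a + b) x

  quotient-of : ∀ {m z e} → K₀ ≤ z → (a + b) * e ≤ p z → + m Signed.∣ eval P (+ z) ℤ.- (+ a ℤ.+ + b) ℤ.* + e →
    ∃ λ q → p z ≡ (a + b) * e + m * q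
  quotient-of {m} {z} {e} K₀≤z fits m∣ = natural-quotient
    (subst₂ (λ i j → + m Signed.∣ i ℤ.- j) (sym (p≡ K₀≤z)) (sym (pos-a+b e)) m∣) fits

  -- By (1), `p k ≡ p t ≡ (a + b) * t ≡ (a + b) * t₀` modulo `d`. The next two lemmas argue likewise
  -- modulo `u`, from (4) and (5).
  p-t-mod-d : ∀ κ → K₀ ≤ t₀ + d * κ → ∃ λ q → p (t₀ + d * κ) ≡ (a + b) * t₀ + d * q
  p-t-mod-d κ K₀≤k = quotient-of K₀≤k (t-fits K₀≤k)
    (subst (+ d Signed.∣_) (rearrange (+ a ℤ.+ + b) t (+ t₀) (eval P (+ (t₀ + d * κ))) (eval P t))
      (Signed.∣m∣n⇒∣m+n (Signed.∣m∣n⇒∣m-n (eval-cong-mod P (t-class κ)) (∣ᵤ⇒∣ h₁))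
        (Signed.∣n⇒∣m*n (+ a ℤ.+ + b) t-residue)))
    where
    rearrange : ∀ s t t₀ x y → x ℤ.- y ℤ.- (s ℤ.* t ℤ.- y) ℤ.+ s ℤ.* (t ℤ.- t₀) ≡ x ℤ.- s ℤ.* t₀
    rearrange = ℤ.solve-∀

  p-v-mod-u : ∀ ζ → K₀ ≤ v₀ + u * ζ → ∃ λ q → p (v₀ + u * ζ) ≡ (a + b) * v₀ + u * q
  p-v-mod-u ζ K₀≤z = quotient-of K₀≤z (v-fits K₀≤z)
    (subst (+ u Signed.∣_) (rearrange (+ a ℤ.+ + b) v (+ v₀) (eval P (+ (v₀ + u * ζ))) (eval P v))
      (Signed.∣m∣n⇒∣m+n (Signed.∣m∣n⇒∣m+n (eval-cong-mod P (v-class ζ)) (∣ᵤ⇒∣ h₄))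
        (Signed.∣n⇒∣m*n (+ a ℤ.+ + b) v-residue)))
    where
    rearrange : ∀ s v v₀ x y → x ℤ.- y ℤ.+ (y ℤ.- s ℤ.* v) ℤ.+ s ℤ.* (v ℤ.- v₀) ≡ x ℤ.- s ℤ.* v₀
    rearrange = ℤ.solve-∀

  p-t-mod-u : ∀ κ → K₀ ≤ t₀ + d * κ → ∃ λ q → p (t₀ + d * κ) ≡ (a + b) * v₀ + u * q
  p-t-mod-u κ K₀≤k = quotient-of K₀≤k (v-fits K₀≤k)
    (subst (+ u Signed.∣_) (rearrange (+ a ℤ.+ + b) v (+ v₀) (eval P (+ (t₀ + d * κ))))
      (Signed.∣m∣n⇒∣m+n (∣ᵤ⇒∣ {i = eval P (+ (t₀ + d * κ)) ℤ.- (+ a ℤ.+ + b) ℤ.* v} (h₅ (+ (t₀ + d * κ)) (∣⇒∣ᵤ (t-class κ))))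
        (Signed.∣n⇒∣m*n (+ a ℤ.+ + b) v-residue)))
    where
    rearrange : ∀ s v v₀ x → x ℤ.- s ℤ.* v ℤ.+ s ℤ.* (v ℤ.- v₀) ≡ x ℤ.- s ℤ.* v₀
    rearrange = ℤ.solve-∀

  p-t-mod-b : ∀ κ J → K₀ ≤ t₀ + d * κ → a * (v₀ + u * J) ≤ p (t₀ + d * κ) →
    ∃ λ y → a * (v₀ + u * J) + b * y ≡ p (t₀ + d * κ)
  p-t-mod-b κ J K₀≤k fits with natural-quotient
    (subst₂ (λ i j → + b Signed.∣ i ℤ.- j) (sym (p≡ K₀≤k)) (sym (ℤ.pos-* a (v₀ + u * J)))
      (∣ᵤ⇒∣ (h₆ (+ (v₀ + u * J)) (+ (t₀ + d * κ)) (∣⇒∣ᵤ (v-class J)) (∣⇒∣ᵤ (t-class κ))))) fits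
  ... | y , eq = y , sym eq

  p-step : ∀ κ → let k = t₀ + d * κ in K₀ ≤ k →
    ∃ λ m → p (k + d) ≡ p k + a * (u * m) × ¬ (2 ℕ.∣ m) × Coprime m a × Coprime m b
  p-step κ K₀≤k = from-m (natural-quotient
      (subst₂ (λ i j → + a Signed.∣ i ℤ.- j) (sym (p≡ K₀≤k+d)) (sym (p≡ K₀≤k)) (∣ᵤ⇒∣ (h₂ (+ k) (∣⇒∣ᵤ (t-class κ)))))
      (≤-trans (m≤m+n (p k) k) (p-inc K₀≤k)))
    where
    k = t₀ + d * κ
    K₀≤k+d : K₀ ≤ k + d
    K₀≤k+d = ≤-trans K₀≤k (m≤m+n k d)
    from-m : (∃ λ m → p (k + d) ≡ p k + a * m) →
      ∃ λ m → p (k + d) ≡ p k + a * (u * m) × ¬ (2 ℕ.∣ m) × Coprime m a × Coprime m b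
    from-m (m , eq) = from-m′ (h₃ (+ k) (∣⇒∣ᵤ (t-class κ)) (+ m) am≡)
      where
      open ≡-Reasoning
      cancel : ∀ x y → y ≡ x ℤ.+ y ℤ.- x
      cancel = ℤ.solve-∀
      am≡ : + a ℤ.* + m ≡ eval P (+ k ℤ.+ + d) ℤ.- eval P (+ k)
      am≡ = begin
        + a ℤ.* + m                          ≡⟨ ℤ.pos-* a m ⟨
        + (a * m)                            ≡⟨ cancel (+ p k) (+ (a * m)) ⟩
        + (p k + a * m) ℤ.- + p k            ≡⟨ cong (λ i → + i ℤ.- + p k) eq ⟨
        + p (k + d) ℤ.- + p k                ≡⟨ cong₂ ℤ._-_ (p≡ K₀≤k+d) (p≡ K₀≤k) ⟩
        eval P (+ k ℤ.+ + d) ℤ.- eval P (+ k) ∎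
      from-m′ : (+ u ∣ + m) × ((m′ : ℤ) → + u ℤ.* m′ ≡ + m →
        (¬ (+ 2 ∣ m′)) × (gcd (+ a) m′ ≡ 1ℤ) × (gcd (+ b) m′ ≡ 1ℤ) × (gcd (+ u) m′ ≡ 1ℤ)) →
        ∃ λ m → p (k + d) ≡ p k + a * (u * m) × ¬ (2 ℕ.∣ m) × Coprime m a × Coprime m b
      from-m′ (ℕ.divides m′ m≡ , coprimality)
        with coprimality (+ m′) (trans (sym (ℤ.pos-* u m′)) (cong (+_) (trans (*-comm u m′) (sym m≡))))
      ... | 2∤m′ , coa , cob , _ = m′ , trans eq (cong (λ i → p k + a * i) (trans m≡ (*-comm m′ u))) , 2∤m′ ,
            coprime-sym (gcd≡1⇒coprime (ℤ.+-injective coa)) , coprime-sym (gcd≡1⇒coprime (ℤ.+-injective cob))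

  module S = Switches {Solution} c {a} {b} {d} {u} {t₀} {v₀} p K₀ 0<a 0<b 0<u v₀<u coab mono p-step p-v-mod-u p-t-mod-u p-t-mod-b p-slow p-fast p-increasing

  γ : ℕ → Fin 2
  γ κ = c (t₀ + d * κ)

  -- Total by truncated subtraction and division; both are exact from `K₀` on, by `Q-spec`.
  Q : ℕ → ℕ
  Q κ = (p (t₀ + d * κ) ∸ (a + b) * t₀) / d

  κ≤k : ∀ κ → κ ≤ t₀ + d * κ
  κ≤k κ = ≤-trans (m≤n*m κ d) (m≤n+m (d * κ) t₀)

  Q-spec : ∀ κ → K₀ ≤ κ → p (t₀ + d * κ) ≡ (a + b) * t₀ + d * Q κ
  Q-spec κ K₀≤κ = quotient-spec {d} {p (t₀ + d * κ)} {(a + b) * t₀} (proj₂ (p-t-mod-d κ (≤-trans K₀≤κ (κ≤k κ))))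

  t-mono : ∀ δ X Y κ → K₀ ≤ κ → 0 < X → 0 < Y → a * X + b * Y ≡ Q κ →
    γ X ≡ δ → γ Y ≡ δ → γ κ ≡ δ → Solution
  t-mono δ X Y κ K₀≤κ 0<X 0<Y eq = mono δ (t₀ + d * X) (t₀ + d * Y) (t₀ + d * κ) (≤-trans K₀≤κ (κ≤k κ))
    (<-≤-trans 0<X (κ≤k X)) (<-≤-trans 0<Y (κ≤k Y))
    (trans (rearrange a b d t₀ X Y) (trans (cong (λ i → (a + b) * t₀ + d * i) eq) (sym (Q-spec κ K₀≤κ))))
    where
    rearrange : ∀ a b d t X Y → a * (t + d * X) + b * (t + d * Y) ≡ (a + b) * t + d * (a * X + b * Y)
    rearrange = solve-∀

  next : ∀ κ → t₀ + d * κ + d ≡ t₀ + d * suc κ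
  next κ = rearrange t₀ d κ
    where
    rearrange : ∀ t d κ → t + d * κ + d ≡ t + d * suc κ
    rearrange = solve-∀

  e : ℕ
  e = (a + b) * t₀

  Q-gap : ∀ C → Eventually λ κ → Q κ + C ≤ Q (suc κ)
  Q-gap C = eventually-map step (at-least K₀ ∧ at-least C)
    where
    step : ∀ κ → K₀ ≤ κ × C ≤ κ → Q κ + C ≤ Q (suc κ)
    step κ (K₀≤κ , C≤κ) = *-cancelˡ-≤ d (≤-from t₀
      (+-mono-≤ (subst₂ (λ i j → i + (t₀ + d * κ) ≤ j) (Q-spec κ K₀≤κ)
          (trans (cong p (next κ)) (Q-spec (suc κ) (m≤n⇒m≤1+n K₀≤κ))) (p-inc (≤-trans K₀≤κ (κ≤k κ))))
        (*-monoʳ-≤ d C≤κ))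
      (rearrange d (Q κ) (Q (suc κ)) κ C e t₀))
      where
      rearrange : ∀ d Q Q′ κ C e t → d * (Q + C) + (e + d * Q′ + d * κ) + t ≡ d * Q′ + (e + d * Q + (t + d * κ) + d * C)
      rearrange = solve-∀

  -- The increment of `p` at `k` is at least `k`, while `suc C` times it is at most `p k`. Hence
  -- `suc C * k ≤ p k`, and the extra `k` absorbs `e`.
  Q-superlinear : ∀ C → Eventually λ κ → C * κ ≤ Q κ
  Q-superlinear C = eventually-map step (onwards (p-slow (suc C) 1) ∧ at-least K₀ ∧ at-least e)
    where
    step : ∀ κ → (∀ z → κ ≤ z → ∀ k → z ≤ k → k ≤ 1 * z → suc C * p (k + d) ≤ suc C * p k + p z) × K₀ ≤ κ × e ≤ κ →
      C * κ ≤ Q κ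
    step κ (slow , K₀≤κ , e≤κ) = *-cancelˡ-≤ d (≤-from (C * t₀)
      (+-mono-≤ (slow k (κ≤k κ) k ≤-refl (≤-reflexive (sym (*-identityˡ k))))
        (+-mono-≤ (*-monoʳ-≤ (suc C) (p-inc (≤-trans K₀≤κ (κ≤k κ))))
          (+-mono-≤ (≤-reflexive (Q-spec κ K₀≤κ)) (≤-trans e≤κ (κ≤k κ)))))
      (rearrange C d κ (Q κ) (p k) (p (k + d)) e t₀))
      where
      k = t₀ + d * κ
      rearrange : ∀ C d κ Q q q′ e t → d * (C * κ) + (suc C * q + q + (suc C * q′ + (e + d * Q + (t + d * κ)))) + C * t
        ≡ d * Q + (suc C * q′ + (suc C * (q + (t + d * κ)) + (q + e)))
      rearrange = solve-∀

  -- `p-slow` is used with `suc C`: the extra increment, at least `k`, absorbs the constant `e`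
  -- between `p k` and `d * Q κ`.
  Q-slow : ∀ C → Eventually λ κ → C * Q (suc κ) ≤ C * Q κ + Q κ
  Q-slow C = eventually-map step (onwards (p-slow (suc C) 1) ∧ at-least K₀ ∧ at-least e)
    where
    step : ∀ κ → (∀ z → κ ≤ z → ∀ k → z ≤ k → k ≤ 1 * z → suc C * p (k + d) ≤ suc C * p k + p z) × K₀ ≤ κ × e ≤ κ →
      C * Q (suc κ) ≤ C * Q κ + Q κ
    step κ (slow , K₀≤κ , e≤κ) = *-cancelˡ-≤ d (≤-from 0
      (+-mono-≤ (slow k (κ≤k κ) k ≤-refl (≤-reflexive (sym (*-identityˡ k))))
        (+-mono-≤ (p-inc (≤-trans K₀≤κ (κ≤k κ)))
          (+-mono-≤ (*-monoʳ-≤ (suc C) (≤-reflexive (Q-spec κ K₀≤κ))) (+-mono-≤ (*-monoʳ-≤ C (≤-reflexive (sym p′≡))) (≤-trans e≤κ (κ≤k κ))))))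
      (rearrange C d k (Q κ) (Q (suc κ)) (p k) (p (k + d)) e))
      where
      k = t₀ + d * κ
      p′≡ : p (k + d) ≡ e + d * Q (suc κ)
      p′≡ = trans (cong p (next κ)) (Q-spec (suc κ) (m≤n⇒m≤1+n K₀≤κ))
      rearrange : ∀ C d k Q Q′ q q′ e → d * (C * Q′) + (suc C * q + q + (q′ + (suc C * (e + d * Q) + (C * q′ + k)))) + 0
        ≡ d * (C * Q + Q) + (suc C * q′ + (q + k + (suc C * q + (C * (e + d * Q′) + e))))
      rearrange = solve-∀

  solution : Solution
  solution = Blocks.block-solution γ Q K₀ 0<a 0<b coab t-mono
    (λ C 0<C → S.opposite-switches 0<d C 0<C) Q-slow Q-gap Q-superlinear

theorem1p3 : (p : List ℤ) → Deg≥2PosLead p →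
    (a b : ℕ) → 0 < a → 0 < b → gcd (+ a) (+ b) ≡ 1ℤ →
    (d u : ℕ) → 0 < d → 0 < u → (t v : ℤ) →
    ((+ a ℤ.+ + b) ℤ.* t ≡ eval p t [mod + d ]) →
    ((k : ℤ) → k ≡ t [mod + d ] → + a ∣ (eval p (k ℤ.+ + d) ℤ.- eval p k)) →
    ((k : ℤ) → k ≡ t [mod + d ] → (m : ℤ) →
    + a ℤ.* m ≡ eval p (k ℤ.+ + d) ℤ.- eval p k →
    (+ u ∣ m) ×
    ((m′ : ℤ) → + u ℤ.* m′ ≡ m →
    (¬ (+ 2 ∣ m′)) × (gcd (+ a) m′ ≡ 1ℤ) × (gcd (+ b) m′ ≡ 1ℤ) × (gcd (+ u) m′ ≡ 1ℤ))) →
    (eval p v ≡ (+ a ℤ.+ + b) ℤ.* v [mod + u ]) →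
    ((k : ℤ) → k ≡ t [mod + d ] → eval p k ≡ (+ a ℤ.+ + b) ℤ.* v [mod + u ]) →
    ((j k : ℤ) → j ≡ v [mod + u ] → k ≡ t [mod + d ] → + b ∣ (eval p k ℤ.- + a ℤ.* j)) →
    Ramsey 2 (LinPolyEq a b p)
theorem1p3 P (cs , l , refl , 2≤n , 0<l) a b 0<a 0<b gcd[a,b] d@(suc _) u@(suc _) 0<d 0<u t v h₁ h₂ h₃ h₄ h₅ h₆ c N =
  Assembly.solution P p 0<a 0<b (gcd≡1⇒coprime (ℤ.+-injective gcd[a,b])) 0<d 0<u h₁ h₂ h₃ h₄ h₅ h₆ c N p-slow p-fast p-increasing
    (n%ℕd<d v u) (residue-class d t) (residue-class u v) (residue-mod d t) (residue-mod u v)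
    (proj₁ K₀-facts) (proj₂ K₀-facts)
  where
  open Growth 0<l d 0<d cs 2≤n
  K₀-facts : Eventually λ z → suc N ≤ z × + p z ≡ eval P (+ z) × p z + z ≤ p (z + d) ×
    (a + b) * (t %ℕ d) ≤ p z × (a + b) * (v %ℕ u) ≤ p z
  K₀-facts = at-least (suc N) ∧ p-pos ∧ p-increasing ∧ p-unbounded _ ∧ p-unbounded _
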